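{- Let $G$ be a factor-critical graph with at least $7$ vertices. Then $G$ is an edge-stable equimatchable graph if and only if $G$ is a complete graph on an odd number of vertices, or $G\in\mathcal{G}_1$, or $G\in\mathcal{G}_2$, where: $\mathcal{G}_1$ is the family of graphs isomorphic to $K_{2r+1}\setminus M$ for some integer $r\ge 3$ and some nonempty matching $M$ of $K_{2r+1}$ (i.e. the complete graph on $2r+1$ vertices with the edges of $M$ removed); $\mathcal{G}_2$ is the family of graphs $G$ admitting an independent set $S$ with $|S|\ge 3$ such that every vertex of $S$ is adjacent to every vertex of $V(G)\setminus S$, and such that the maximum matching size of the induced subgraph $G[V(G)\setminus S]$ equals $1$.
   Context: All graphs are finite and simple. A matching is maximal if no other matching properly contains it. A graph $G$ is equimatchable if every maximal matching of $G$ has the same cardinality. An equimatchable graph $G$ is edge-stable (an ESE-graph) if $G\setminus e=(V(G),E(G)\setminus\{e\})$ is equimatchable for every $e\in E(G)$. A graph $G$ is factor-critical if $G-v$ has a perfect matching for every $v\in V(G)$. $\nu(H)$ denotes the maximum size of a matching of $H$. -}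

module Defs where

open import Data.Fin using (Fin)
import Data.Fin.Properties as Fin
open import Data.Fin.Subset using (Subset; _∈_; _∉_; ∣_∣)
open import Data.List using (List; []; [_]; length)
open import Data.List.Relation.Unary.All using (All)
open import Data.List.Relation.Unary.AllPairs using (AllPairs)
open import Data.List.Relation.Unary.Any using (Any; any?)
import Data.List.Membership.Propositional as List
open import Data.Nat using (ℕ; _+_; _*_; _≤_)
open import Data.Product using (∃-syntax; Σ-syntax; _×_; _,_; proj₁; proj₂)
open import Data.Product.Properties using (≡-dec)
import Data.Sum as Sum
open import Data.Sum using (_⊎_)
open import Function using (_∘_; _on_)
open import Function.Bundles using (_↔_; _⇔_; Inverse)
open import Level using (0ℓ)
open import Relation.Binary
  using (Rel; Symmetric; Irreflexive; Decidable; DecidableEquality)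
open import Relation.Binary.PropositionalEquality
  using (_≡_; _≢_; refl; cong; ≢-sym)
open import Relation.Nullary using (¬_; ¬?; map′; _×-dec_; _⊎-dec_)
open import Relation.Unary using (Pred)

-- Simple graphs on a vertex type V.  Finiteness is not a field: the graphs of
-- interest live on Fin n, and the vertex-deleted graphs on subtypes of Fin n.
-- The two decision procedures exist for every finite graph classically.
record Graph (V : Set) : Set₁ where
  infix 4 _~_ _~?_ _≟_
  field
    _~_    : Rel V 0ℓ
    ~-sym  : Symmetric _~_
    irrefl : Irreflexive _≡_ _~_
    _~?_   : Decidable _~_
    _≟_    : DecidableEquality V

open Graph using () renaming (_~_ to Adj)

-- A finite set of undirected edges is a list of pairs in which (u , v) and
-- (v , u) both stand for the edge uv; all comparisons of edge sets go
-- through Has, which ignores the orientation.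
Edges : Set → Set
Edges V = List (V × V)

module _ {V : Set} where

  Has : Edges V → V → V → Set
  Has M u v = (u , v) List.∈ M ⊎ (v , u) List.∈ M

  infix 4 _⊂ₑ_ _⊆ₑ_

  _⊆ₑ_ : Edges V → Edges V → Set
  M ⊆ₑ N = ∀ u v → Has M u v → Has N u v

  _⊂ₑ_ : Edges V → Edges V → Set
  M ⊂ₑ N = M ⊆ₑ N × ¬ (N ⊆ₑ M)

  Disjoint : V × V → V × V → Set
  Disjoint (a , b) (c , d) = a ≢ c × a ≢ d × b ≢ c × b ≢ d

  Covers : Edges V → V → Set
  Covers M v = Any (λ e → v ≡ proj₁ e ⊎ v ≡ proj₂ e) M

  -- Disjointness of the entries excludes repetitions of an edge in either
  -- orientation, so length M is the cardinality of the matching.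
  IsMatching : Graph V → Edges V → Set
  IsMatching G M = All (λ e → Adj G (proj₁ e) (proj₂ e)) M × AllPairs Disjoint M

  IsMaximalMatching : Graph V → Edges V → Set
  IsMaximalMatching G M =
    IsMatching G M × ¬ (∃[ N ] (IsMatching G N × M ⊂ₑ N))

  IsPerfectMatching : Graph V → Edges V → Set
  IsPerfectMatching G M = IsMatching G M × (∀ v → Covers M v)

  -- ν(G) = k
  MatchingNumber : Graph V → ℕ → Set
  MatchingNumber G k =
    (∃[ M ] (IsMatching G M × length M ≡ k)) ×
    (∀ M → IsMatching G M → length M ≤ k)

  Equimatchable : Graph V → Set
  Equimatchable G =
    ∀ M N → IsMaximalMatching G M → IsMaximalMatching G N → length M ≡ length N

  infixl 6 _∖_ _─_

  _∖_ : Graph V → Edges V → Graph V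
  G ∖ M = record
    { _~_    = λ u v → u ~ v × ¬ Has M u v
    ; ~-sym  = λ (p , q) → ~-sym p , q ∘ Sum.swap
    ; irrefl = λ eq (p , _) → irrefl eq p
    ; _~?_   = λ u v → (u ~? v) ×-dec ¬? (has? u v)
    ; _≟_    = _≟_
    }
    where
    open Graph G
    has? : Decidable (Has M)
    has? u v = any? (≡-dec _≟_ _≟_ (u , v)) M ⊎-dec any? (≡-dec _≟_ _≟_ (v , u)) M

  -- G ─ X is the subgraph induced on the vertices not satisfying X.
  -- Two proofs of ¬ X u are definitionally equal, so the vertices of G ─ X
  -- are not duplicated by the subtype.
  _─_ : Graph V → (X : Pred V 0ℓ) → Graph (Σ[ u ∈ V ] ¬ X u)
  G ─ X = record
    { _~_    = _~_ on proj₁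
    ; ~-sym  = ~-sym
    ; irrefl = λ eq → irrefl (cong proj₁ eq)
    ; _~?_   = λ u v → proj₁ u ~? proj₁ v
    ; _≟_    = λ u v → map′ (λ { refl → refl }) (cong proj₁) (proj₁ u ≟ proj₁ v)
    }
    where open Graph G

module _ {V : Set} where

  EdgeStableEquimatchable : Graph V → Set
  EdgeStableEquimatchable G =
    Equimatchable G × (∀ u v → Adj G u v → Equimatchable (G ∖ [ (u , v) ]))

  FactorCritical : Graph V → Set
  FactorCritical G = ∀ v → ∃[ M ] IsPerfectMatching (G ─ (_≡ v)) M

  Complete : Graph V → Set
  Complete G = ∀ u v → u ≢ v → Adj G u v

infix 4 _≅_

_≅_ : ∀ {V W} → Graph V → Graph W → Set
_≅_ {V} {W} G H =
  Σ[ f ∈ V ↔ W ] (∀ u v → Adj G u v ⇔ Adj H (Inverse.to f u) (Inverse.to f v))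

K : ∀ n → Graph (Fin n)
K n = record
  { _~_    = _≢_
  ; ~-sym  = ≢-sym
  ; irrefl = λ eq neq → neq eq
  ; _~?_   = λ u v → ¬? (u Fin.≟ v)
  ; _≟_    = Fin._≟_
  }

module _ {n : ℕ} where

  OddComplete : Graph (Fin n) → Set
  OddComplete G = Complete G × ∃[ r ] n ≡ 2 * r + 1

  𝒢₁ : Graph (Fin n) → Set
  𝒢₁ G = ∃[ r ] (3 ≤ r × ∃[ M ]
    (IsMatching (K (2 * r + 1)) M × M ≢ [] × G ≅ K (2 * r + 1) ∖ M))

  𝒢₂ : Graph (Fin n) → Set
  𝒢₂ G = Σ[ S ∈ Subset n ]
    ( (∀ u v → u ∈ S → v ∈ S → ¬ Adj G u v)
    × 3 ≤ ∣ S ∣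
    × (∀ u v → u ∈ S → v ∉ S → Adj G u v)
    × MatchingNumber (G ─ (_∈ S)) 1
    )

module Submission where

-- Write U for the vertices missed by a matching.  In a factor-critical graph
-- edge-stability says that no matching missing exactly three vertices leaves
-- fewer than two edges among them (`triangle` below).  If some v has two
-- non-neighbours, fix a matching missing only v: every matching edge meets the
-- neighbourhood N(v), and exchanging a few edges so that `triangle` applies
-- gives the whole structure.  If no matching edge lies inside N(v), then
-- S = N(v) witnesses 𝒢₂.  If exactly one does and all non-neighbours of v are
-- joined to it, then S = V ∖ N(v) does.  In the remaining cases one can restart
-- from a non-neighbour of v and is in the first case.  If no vertex has two
-- non-neighbours, the complement of G is a matching.
--
-- Conversely, a maximal matching of G or G ∖ e misses a set U with at most one
-- edge of G; in the families this gives ∣ U ∣ ≤ 2, for 𝒢₂ by comparing how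
-- often the matching edges meet S and V ∖ S.

open import Defs
open import Data.Nat using (ℕ; _≤_)
open import Data.Fin using (Fin)
open import Data.Sum using (_⊎_)
open import Function.Bundles using (_⇔_)

open import Data.Bool as Bool using (Bool; true; false; not)
open import Data.Bool.Properties using (¬-not)
open import Data.Empty using (⊥; ⊥-elim)
import Data.Fin as Fin
import Data.Fin.Properties as Fin
open import Data.Fin.Subset as Subset using (Subset; ∣_∣)
open import Data.Fin.Subset.Properties as Subset
  using (x∈p⇒∣p-x∣<∣p∣; x∈p∧x≢y⇒x∈p-y)
open import Data.List
  using (List; []; _∷_; [_]; _++_; length; map; filter; allFin; cartesianProduct)
open import Data.List.Membership.Propositional using (_∈_; _∉_)
open import Data.List.Membership.Propositional.Properties
  using (∈-++⁻; ∈-++⁺ˡ; ∈-++⁺ʳ; ∈-allFin; ∈-AllPairs₂; ∈-filter⁺; ∈-filter⁻;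
         ∈-cartesianProduct⁺)
open import Data.List.Membership.Propositional.Properties.WithK
  using (unique∧set⇒bag)
open import Data.List.Properties using (length-tabulate; length-++)
open import Data.List.Relation.Binary.BagAndSetEquality using (∼bag⇒↭)
open import Data.List.Relation.Binary.Permutation.Propositional
  using (_↭_; ↭-refl; ↭-sym; ↭-trans; prep; swap; ↭⇒↭ₛ)
open import Data.List.Relation.Binary.Permutation.Propositional.Properties
  using (map⁺; ∈-resp-↭; ↭-length; shifts; ++⁺ʳ; ++⁺ˡ)
import Data.List.Relation.Binary.Permutation.Setoid.Properties as Permₛ
open import Data.List.Relation.Unary.All as All using (All; []; _∷_)
import Data.List.Relation.Unary.All.Properties as All
open import Data.List.Relation.Unary.AllPairs as AllPairs using (AllPairs; []; _∷_)
import Data.List.Relation.Unary.AllPairs.Properties as AllPairs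
open import Data.List.Relation.Unary.Any as Any using (here; there)
import Data.List.Relation.Unary.Any.Properties as Any
open import Data.List.Relation.Unary.Unique.Propositional using (Unique)
import Data.List.Relation.Unary.Unique.Propositional.Properties as Unique
open import Data.Nat using (zero; suc; _+_; _*_; _∸_; _<_; z≤n; s≤s)
open import Data.Nat.ListAction using (sum)
open import Data.Nat.ListAction.Properties using (sum-↭)
open import Data.Nat.Properties
open import Data.Product using (Σ-syntax; ∃-syntax; _×_; _,_; proj₁; proj₂; uncurry)
open import Data.Sum using (inj₁; inj₂; [_,_]′)
import Data.Sum as Sum
open import Data.Vec using (lookup; tabulate)
open import Data.Vec.Properties using (lookup∘tabulate; lookup⇒[]=; []=⇒lookup)
open import Function using (_∘_; mk⇔; case_of_)
open import Function.Bundles using (Equivalence; Inverse)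
open import Function.Construct.Identity using (↔-id)
open import Level using (0ℓ)
open import Relation.Binary using (Rel; Symmetric; Decidable)
open import Relation.Binary.Definitions using (tri<; tri≈; tri>)
open import Relation.Binary.PropositionalEquality
  using (_≡_; _≢_; refl; sym; trans; cong; subst; setoid; ≢-sym; module ≡-Reasoning)
open import Relation.Nullary using (¬_; yes; no; ¬?; Dec; contradiction; _×-dec_; _⊎-dec_)
open import Relation.Nullary.Decidable using (decidable-stable; does; dec-true; dec-false)
open import Relation.Unary as Unary using (Pred)

open Graph using () renaming (_~_ to Adj)

-- Endpoints of matchings, and maximality

module _ {V : Set} where

  ends : Edges V → List V
  ends []            = []
  ends ((u , w) ∷ M) = u ∷ w ∷ ends M

  length-ends : ∀ M → length (ends M) ≡ 2 * length M
  length-ends []      = refl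
  length-ends (e ∷ M) = trans (cong (suc ∘ suc) (length-ends M)) (sym (*-suc 2 (length M)))

  covers⇒∈ends : ∀ {M v} → Covers M v → v ∈ ends M
  covers⇒∈ends {_ ∷ M} (here (inj₁ eq)) = here eq
  covers⇒∈ends {_ ∷ M} (here (inj₂ eq)) = there (here eq)
  covers⇒∈ends {_ ∷ M} (there p)        = there (there (covers⇒∈ends p))

  ∈ends⇒covers : ∀ {M v} → v ∈ ends M → Covers M v
  ∈ends⇒covers {_ ∷ M} (here eq)         = here (inj₁ eq)
  ∈ends⇒covers {_ ∷ M} (there (here eq)) = here (inj₂ eq)
  ∈ends⇒covers {_ ∷ M} (there (there p)) = there (∈ends⇒covers p)

  ∈⇒∈ends : ∀ {M u w} → (u , w) ∈ M → u ∈ ends M × w ∈ ends M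
  ∈⇒∈ends {_ ∷ M} (here refl) = here refl , there (here refl)
  ∈⇒∈ends {_ ∷ M} (there p)   =
    let p₁ , p₂ = ∈⇒∈ends p in there (there p₁) , there (there p₂)

  partner-in : ∀ {M u} → u ∈ ends M → ∃[ w ] Has M u w
  partner-in {(u , w) ∷ M} (here refl)         = w , inj₁ (here refl)
  partner-in {(u , w) ∷ M} (there (here refl)) = u , inj₂ (here refl)
  partner-in {_ ∷ M}       (there (there p))   =
    let w , has = partner-in p in w , Sum.map there there has

  All-ends⁺ : ∀ {P : Pred V 0ℓ} {M} →
              All (λ e → P (proj₁ e) × P (proj₂ e)) M → All P (ends M)
  All-ends⁺ []              = []
  All-ends⁺ ((p , q) ∷ pqs) = p ∷ q ∷ All-ends⁺ pqs

  All-ends⁻ : ∀ {P : Pred V 0ℓ} M →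
              All P (ends M) → All (λ e → P (proj₁ e) × P (proj₂ e)) M
  All-ends⁻ []      []           = []
  All-ends⁻ (e ∷ M) (p ∷ q ∷ pqs) = (p , q) ∷ All-ends⁻ M pqs

  disjoint⇒unique : ∀ {M} → All (uncurry _≢_) M → AllPairs Disjoint M → Unique (ends M)
  disjoint⇒unique []         []         = []
  disjoint⇒unique (ne ∷ nes) (ds ∷ dss) =
    (ne ∷ All-ends⁺ (All.map (λ (a , b , _ , _) → a , b) ds))
    ∷ All-ends⁺ (All.map (λ (_ , _ , c , d) → c , d) ds)
    ∷ disjoint⇒unique nes dss

  unique⇒disjoint : ∀ M → Unique (ends M) → AllPairs Disjoint M
  unique⇒disjoint []      _                      = []
  unique⇒disjoint (e ∷ M) ((_ ∷ us) ∷ ws ∷ rest) =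
    All.zipWith (λ ((a , b) , (c , d)) → a , b , c , d) (All-ends⁻ M us , All-ends⁻ M ws)
    ∷ unique⇒disjoint M rest

  AllPairs-with-All : ∀ {P : Pred V 0ℓ} {R : Rel V 0ℓ} {xs} →
                      All P xs → AllPairs R xs → AllPairs (λ x y → P x × P y × R x y) xs
  AllPairs-with-All []       []         = []
  AllPairs-with-All (p ∷ ps) (rs ∷ rss) =
    All.zipWith (λ (q , r) → p , q , r) (ps , rs) ∷ AllPairs-with-All ps rss

  module _ (G : Graph V) where
    open Graph G

    adjacent⇒≢ : ∀ {u w} → u ~ w → u ≢ w
    adjacent⇒≢ u~w eq = irrefl eq u~w

    matching⇒unique : ∀ {M} → IsMatching G M → Unique (ends M)
    matching⇒unique (adj , disj) = disjoint⇒unique (All.map adjacent⇒≢ adj) disj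

    Has⇒Adj : ∀ {M u w} → All (uncurry _~_) M → Has M u w → u ~ w
    Has⇒Adj adj (inj₁ p) = All.lookup adj p
    Has⇒Adj adj (inj₂ p) = ~-sym (All.lookup adj p)

    partner-unique : ∀ {M x y z} → IsMatching G M → Has M x y → Has M x z → y ≡ z
    partner-unique (adj , disj) (inj₁ p) (inj₁ q) with ∈-AllPairs₂ disj p q
    ... | inj₁ refl                      = refl
    ... | inj₂ (inj₁ (x≢x , _))          = contradiction refl x≢x
    ... | inj₂ (inj₂ (x≢x , _))          = contradiction refl x≢x
    partner-unique (adj , disj) (inj₁ p) (inj₂ q) with ∈-AllPairs₂ disj p q
    ... | inj₁ refl                      = refl
    ... | inj₂ (inj₁ (_ , x≢x , _))      = contradiction refl x≢x
    ... | inj₂ (inj₂ (_ , _ , x≢x , _))  = contradiction refl x≢x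
    partner-unique (adj , disj) (inj₂ p) (inj₁ q) with ∈-AllPairs₂ disj p q
    ... | inj₁ refl                      = refl
    ... | inj₂ (inj₁ (_ , _ , x≢x , _))  = contradiction refl x≢x
    ... | inj₂ (inj₂ (_ , x≢x , _))      = contradiction refl x≢x
    partner-unique (adj , disj) (inj₂ p) (inj₂ q) with ∈-AllPairs₂ disj p q
    ... | inj₁ refl                      = refl
    ... | inj₂ (inj₁ (_ , _ , _ , x≢x))  = contradiction refl x≢x
    ... | inj₂ (inj₂ (_ , _ , _ , x≢x))  = contradiction refl x≢x

    -- Each edge of a larger matching `N` has an end covered by `M`. The edge of `M` at that end
    -- also lies in `N`, so the two are the same edge.
    maximal-if-covering : ∀ {M} → IsMatching G M →
                          (∀ {u w} → u ~ w → u ∈ ends M ⊎ w ∈ ends M) → IsMaximalMatching G M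
    maximal-if-covering {M} matching covering = matching , not-extendable
      where
      not-extendable : ¬ (∃[ N ] (IsMatching G N × M ⊂ₑ N))
      not-extendable (N , N-matching , M⊆N , N⊈M) = N⊈M N⊆M
        where
        N⊆M : N ⊆ₑ M
        N⊆M u w has with covering (Has⇒Adj (proj₁ N-matching) has)
        ... | inj₁ u∈M =
          let t , has′ = partner-in u∈M in
          subst (Has M u) (partner-unique N-matching (M⊆N u t has′) has) has′
        ... | inj₂ w∈M =
          let t , has′ = partner-in w∈M in
          Sum.swap (subst (Has M w) (partner-unique N-matching (M⊆N w t has′) (Sum.swap has)) has′)

    maximal⇒independent : ∀ {M u w} → IsMaximalMatching G M →
                          u ∉ ends M → w ∉ ends M → ¬ u ~ w
    maximal⇒independent {M} {u} {w} ((adj , disj) , maximal) u∉ w∉ u~w =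
      maximal ((u , w) ∷ M , (u~w ∷ adj , new ∷ disj) , (λ _ _ → Sum.map there there) , bigger)
      where
      new : All (Disjoint (u , w)) M
      new = All.zipWith (λ ((a , b) , (c , d)) → a , b , c , d)
        (All-ends⁻ M (All.¬Any⇒All¬ _ u∉) , All-ends⁻ M (All.¬Any⇒All¬ _ w∉))
      bigger : ¬ ((u , w) ∷ M ⊆ₑ M)
      bigger ⊆M = [ u∉ ∘ proj₁ ∘ ∈⇒∈ends , u∉ ∘ proj₂ ∘ ∈⇒∈ends ]′ (⊆M u w (inj₁ (here refl)))

-- Bringing chosen entries of a list to the front

module _ {A : Set} where

  -- The nonempty list is passed as head and tail, so an entry always exists; a position past the
  -- end yields the last one.
  extract : ℕ → A → List A → A × List A
  extract zero    x xs       = x , xs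
  extract (suc i) x []       = x , []
  extract (suc i) x (y ∷ ys) = let z , zs = extract i y ys in z , x ∷ zs

  extract-↭ : ∀ i x xs → x ∷ xs ↭ uncurry _∷_ (extract i x xs)
  extract-↭ zero    x xs       = ↭-refl
  extract-↭ (suc i) x []       = ↭-refl
  extract-↭ (suc i) x (y ∷ ys) = ↭-trans (prep x (extract-↭ i y ys)) (swap x _ ↭-refl)

  -- arrange [] (i ∷ j ∷ …) xs lists the entries at positions i, j, … of xs
  -- first and then the remaining ones.  Positions refer to the original list,
  -- hence the correction by the positions extracted before; the result is a
  -- permutation even for repeated or too large positions.
  arrange : List ℕ → List ℕ → List A → List A
  arrange seen []       xs       = xs
  arrange seen (i ∷ is) []       = []
  arrange seen (i ∷ is) (x ∷ xs) =
    let y , ys = extract (i ∸ length (filter (_<? i) seen)) x xs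
    in y ∷ arrange (i ∷ seen) is ys

  arrange-↭ : ∀ seen is xs → xs ↭ arrange seen is xs
  arrange-↭ seen []       xs       = ↭-refl
  arrange-↭ seen (i ∷ is) []       = ↭-refl
  arrange-↭ seen (i ∷ is) (x ∷ xs) =
    ↭-trans (extract-↭ j x xs) (prep _ (arrange-↭ (i ∷ seen) is _))
    where
    j : ℕ
    j = i ∸ length (filter (_<? i) seen)

-- Matchings with a prescribed list of missed vertices

module _ {n : ℕ} where

  open import Data.List.Membership.DecPropositional (Fin._≟_ {n}) using (_∈?_)

  spanning⇒unique : ∀ {xs} → xs ↭ allFin n → Unique xs
  spanning⇒unique p =
    Permₛ.Unique-resp-↭ (setoid _) (↭⇒↭ₛ (↭-sym p)) (Unique.allFin⁺ n)

  unique⇒spanning : ∀ {xs} → Unique xs → (∀ v → v ∈ xs) → xs ↭ allFin n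
  unique⇒spanning unique full =
    ∼bag⇒↭ (unique∧set⇒bag unique (Unique.allFin⁺ n)
      (λ {v} → mk⇔ (λ _ → ∈-allFin v) (λ _ → full v)))

  uncovered : ∀ {xs} → Unique xs → ∃[ U ] U ++ xs ↭ allFin n
  uncovered {xs} unique = U , unique⇒spanning
    (Unique.++⁺ (Unique.filter⁺ (λ v → ¬? (v ∈? xs)) (Unique.allFin⁺ n)) unique
      (λ (v∈U , v∈xs) → proj₂ (∈-filter⁻ (λ v → ¬? (v ∈? xs)) {xs = allFin n} v∈U) v∈xs))
    full
    where
    U : List (Fin n)
    U = filter (λ v → ¬? (v ∈? xs)) (allFin n)
    full : ∀ v → v ∈ U ++ xs
    full v with v ∈? xs
    ... | yes v∈xs = ∈-++⁺ʳ U v∈xs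
    ... | no  v∉xs = ∈-++⁺ˡ (∈-filter⁺ (λ v → ¬? (v ∈? xs)) (∈-allFin v) v∉xs)

  order : ∀ U {M} → U ++ ends M ↭ allFin n → n ≡ length U + 2 * length M
  order U {M} p = begin
    n                            ≡⟨ length-tabulate {n = n} (λ i → i) ⟨
    length (allFin n)            ≡⟨ ↭-length p ⟨
    length (U ++ ends M)         ≡⟨ length-++ U ⟩
    length U + length (ends M)   ≡⟨ cong (length U +_) (length-ends M) ⟩
    length U + 2 * length M      ∎
    where open ≡-Reasoning

  disjoint-++ : ∀ {xs ys : List (Fin n)} {v} → Unique (xs ++ ys) → v ∈ xs → v ∉ ys
  disjoint-++ {_ ∷ xs} (new ∷ unique) (here refl) v∈ys = All.lookup new (∈-++⁺ʳ xs v∈ys) refl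
  disjoint-++ {_ ∷ xs} (new ∷ unique) (there v∈xs) v∈ys = disjoint-++ unique v∈xs v∈ys

  unique-++ʳ : ∀ (xs : List (Fin n)) {ys} → Unique (xs ++ ys) → Unique ys
  unique-++ʳ []       unique       = unique
  unique-++ʳ (_ ∷ xs) (_ ∷ unique) = unique-++ʳ xs unique

  Independent : Graph (Fin n) → List (Fin n) → Set
  Independent G U = ∀ {u w} → u ∈ U → w ∈ U → ¬ Adj G u w

  maximal-if-independent : ∀ (G : Graph (Fin n)) {U M} → All (uncurry (Adj G)) M →
    U ++ ends M ↭ allFin n → Independent G U → IsMaximalMatching G M
  maximal-if-independent G {U} {M} adj p independent =
    maximal-if-covering G (adj , unique⇒disjoint M (unique-++ʳ U (spanning⇒unique p))) covering
    where
    covering : ∀ {u w} → Adj G u w → u ∈ ends M ⊎ w ∈ ends M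
    covering {u} {w} u~w with ∈-++⁻ U (∈-resp-↭ (↭-sym p) (∈-allFin u))
                            | ∈-++⁻ U (∈-resp-↭ (↭-sym p) (∈-allFin w))
    ... | inj₂ u∈ | _       = inj₁ u∈
    ... | inj₁ _  | inj₂ w∈ = inj₂ w∈
    ... | inj₁ u∈ | inj₁ w∈ = contradiction u~w (independent u∈ w∈)

  maximal⇒uncovered-independent : ∀ (G : Graph (Fin n)) {M} → IsMaximalMatching G M →
    ∃[ U ] (U ++ ends M ↭ allFin n × Independent G U)
  maximal⇒uncovered-independent G {M} maximal@(matching , _) =
    let U , p = uncovered (matching⇒unique G matching)
        unique = spanning⇒unique p
    in U , p , λ u∈ w∈ → maximal⇒independent G maximal (disjoint-++ unique u∈) (disjoint-++ unique w∈)

  -- That xs ++ ends M permutes all vertices makes M a matching missing exactly xs.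
  Leaves : Rel (Fin n) 0ℓ → List (Fin n) → Set
  Leaves E xs = ∃[ M ] (All (uncurry E) M × xs ++ ends M ↭ allFin n)

  match : ∀ {E u w xs} → E u w → Leaves E (u ∷ w ∷ xs) → Leaves E xs
  match {u = u} {w} {xs} e (M , es , p) =
    (u , w) ∷ M , e ∷ es , ↭-trans (shifts xs (u ∷ w ∷ [])) p

  weaken : ∀ {E F xs} → (∀ {u w} → E u w → F u w) → Leaves E xs → Leaves F xs
  weaken f (M , es , p) = M , All.map f es , p

  reorder : ∀ {E xs ys} → xs ↭ ys → Leaves E xs → Leaves E ys
  reorder q (M , es , p) = M , es , ↭-trans (++⁺ʳ (ends M) (↭-sym q)) p

  -- With `match` this performs all exchanges below. Removed edges have their ends in the missed
  -- list; `is` brings the ends of the new edges to the front in pairs, `match` adds these edges,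
  -- and the rest of the list is the new missed set.
  move : ∀ {E xs} is → Leaves E xs → Leaves E (arrange [] is xs)
  move {xs = xs} is = reorder (arrange-↭ [] is xs)

  detach : ∀ {E : Rel (Fin n) 0ℓ} → Symmetric E → ∀ {M u} → All (uncurry E) M → u ∈ ends M →
           ∃[ w ] ∃[ M′ ] (E u w × All (uncurry E) M′ × ends M ↭ u ∷ w ∷ ends M′)
  detach E-sym {(u , w) ∷ M} (e ∷ es) (here refl)         = w , M , e , es , ↭-refl
  detach E-sym {(w , u) ∷ M} (e ∷ es) (there (here refl)) =
    w , M , E-sym e , es , swap w u ↭-refl
  detach E-sym {(a , b) ∷ M} (e ∷ es) (there (there p))   =
    let w , M′ , e′ , es′ , q = detach E-sym es p
    in w , (a , b) ∷ M′ , e′ , e ∷ es′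
         , ↭-trans (prep a (prep b q)) (shifts (a ∷ b ∷ []) (_ ∷ w ∷ []))

  partner : ∀ {E : Rel (Fin n) 0ℓ} → Symmetric E → ∀ {xs u} → Leaves E xs → All (u ≢_) xs →
            ∃[ w ] (E u w × Leaves E (u ∷ w ∷ xs))
  partner E-sym {xs} {u} (M , es , p) u∉xs with ∈-++⁻ xs (∈-resp-↭ (↭-sym p) (∈-allFin u))
  ... | inj₁ u∈xs = contradiction u∈xs (All.All¬⇒¬Any u∉xs)
  ... | inj₂ u∈M  =
    let w , M′ , e , es′ , q = detach E-sym es u∈M
    in w , e , M′ , es′
         , ↭-trans (shifts (u ∷ w ∷ []) xs) (↭-trans (++⁺ˡ xs (↭-sym q)) p)

  nonempty : ∀ {E xs} → Leaves E xs → length xs < n →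
             ∃[ u ] ∃[ w ] (E u w × Leaves E (u ∷ w ∷ xs))
  nonempty {xs = xs} ([] , _ , p) small =
    contradiction (subst (_≤ length xs) (sym (trans (order xs {[]} p) (+-identityʳ _))) ≤-refl)
      (<⇒≱ small)
  nonempty {xs = xs} ((u , w) ∷ M , e ∷ es , p) _ =
    u , w , e , M , es , ↭-trans (shifts (u ∷ w ∷ []) xs) p

  -- During the recursion the edges that fail `Q` are set aside in the missed list; they are matched
  -- again afterwards.
  search : ∀ {E Q : Rel (Fin n) 0ℓ} → Decidable Q → ∀ {xs} → Leaves E xs →
           (∃[ u ] ∃[ w ] (E u w × Q u w × Leaves E (u ∷ w ∷ xs)))
           ⊎ Leaves (λ u w → E u w × ¬ Q u w) xs
  search {E} {Q} Q? (M , es , p) = go _ M es p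
    where
    go : ∀ xs M → All (uncurry E) M → xs ++ ends M ↭ allFin n →
         (∃[ u ] ∃[ w ] (E u w × Q u w × Leaves E (u ∷ w ∷ xs)))
         ⊎ Leaves (λ u w → E u w × ¬ Q u w) xs
    go xs []            []       p = inj₂ ([] , [] , p)
    go xs ((u , w) ∷ M) (e ∷ es) p with ↭-trans (shifts (u ∷ w ∷ []) xs) p | Q? u w
    ... | p′ | yes q = inj₁ (u , w , e , q , M , es , p′)
    ... | p′ | no ¬q with go (u ∷ w ∷ xs) M es p′
    ...   | inj₁ (a , b , e′ , q , L) = inj₁ (a , b , e′ , q , match e (move (2 ∷ 3 ∷ []) L))
    ...   | inj₂ L                    = inj₂ (match (e , ¬q) L)

  -- From edge-stability to missed triples

  -- The subgraph induced on `U` has maximum degree at most one; for three vertices this means at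
  -- most one edge.
  Sparse : Graph (Fin n) → List (Fin n) → Set
  Sparse G U = ∀ {x y z} → x ∈ U → y ∈ U → z ∈ U → y ≢ z → Adj G x y → ¬ Adj G x z

  factorCritical⇒leaves : ∀ {G : Graph (Fin n)} → FactorCritical G → ∀ v → Leaves (Adj G) [ v ]
  factorCritical⇒leaves {G} critical v with critical v
  ... | M , (adj , disj) , covers =
    M′ , adj′ , unique⇒spanning (v∉M′ ∷ matching⇒unique G (adj′ , disj′)) full
    where
    forget : Σ[ u ∈ Fin n ] ¬ u ≡ v → Fin n
    forget = proj₁
    M′ : Edges (Fin n)
    M′ = map (λ e → forget (proj₁ e) , forget (proj₂ e)) M
    adj′ : All (uncurry (Adj G)) M′
    adj′ = All.map⁺ adj
    disj′ : AllPairs Disjoint M′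
    disj′ = AllPairs.map⁺ (AllPairs.map
      (λ (a , b , c , d) → a ∘ lift , b ∘ lift , c ∘ lift , d ∘ lift) disj)
      where
      lift : ∀ {u w : Σ[ u ∈ Fin n ] ¬ u ≡ v} → proj₁ u ≡ proj₁ w → u ≡ w
      lift refl = refl
    v∉M′ : All (v ≢_) (ends M′)
    v∉M′ = All-ends⁺ (All.map⁺ (All.universal (λ ((_ , a) , (_ , b)) → ≢-sym a , ≢-sym b) M))
    full : ∀ w → w ∈ v ∷ ends M′
    full w with w Fin.≟ v
    ... | yes w≡v = here w≡v
    ... | no  w≢v = there (covers⇒∈ends (Any.map⁺
      (Any.map (Sum.map (cong forget) (cong forget)) (covers (w , w≢v)))))

  -- Both matchings would be maximal, as the vertices they miss are independent, but the one missing
  -- three vertices has one edge fewer.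
  equimatchable⇒no-independent-triple :
    ∀ {H : Graph (Fin n)} → Equimatchable H → ∀ {x y z} →
    Leaves (Adj H) (x ∷ y ∷ z ∷ []) → Leaves (Adj H) [ y ] → ¬ Independent H (x ∷ y ∷ z ∷ [])
  equimatchable⇒no-independent-triple {H} equi {y = y} (M , adj , p) (N , adj′ , q) independent =
    1+n≢n (*-cancelˡ-≡ _ _ 2 (suc-injective (begin
      suc (2 * suc (length M))   ≡⟨ cong suc (*-suc 2 (length M)) ⟩
      3 + 2 * length M           ≡⟨ order (_ ∷ _ ∷ _ ∷ []) p ⟨
      n                          ≡⟨ order [ _ ] q ⟩
      1 + 2 * length N           ≡⟨ cong (λ l → 1 + 2 * l) same ⟨
      suc (2 * length M)         ∎)))
    where
    open ≡-Reasoning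
    loopless : Independent H [ y ]
    loopless (here refl) (here refl) = Graph.irrefl H refl
    same : length M ≡ length N
    same = equi M N (maximal-if-independent H adj p independent)
                    (maximal-if-independent H adj′ q loopless)

  triple-independent : ∀ (H : Graph (Fin n)) {x y z} →
    ¬ Adj H x y → ¬ Adj H x z → ¬ Adj H y z → Independent H (x ∷ y ∷ z ∷ [])
  triple-independent H x≁y x≁z y≁z = λ where
      (here refl)                 (here refl)                 → irrefl refl
      (here refl)                 (there (here refl))         → x≁y
      (here refl)                 (there (there (here refl))) → x≁z
      (there (here refl))         (here refl)                 → x≁y ∘ ~-sym
      (there (here refl))         (there (here refl))         → irrefl refl
      (there (here refl))         (there (there (here refl))) → y≁z
      (there (there (here refl))) (here refl)                 → x≁z ∘ ~-sym
      (there (there (here refl))) (there (here refl))         → y≁z ∘ ~-sym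
      (there (there (here refl))) (there (there (here refl))) → irrefl refl
    where open Graph H

  -- No matching edge meets the missed vertex `y`, so none of them is `yz`.
  leaves-∖ : ∀ (G : Graph (Fin n)) z {xs y} → Leaves (Adj G) xs → y ∈ xs →
             Leaves (Adj (G ∖ [ (y , z) ])) xs
  leaves-∖ G z {xs} {y} (M , adj , p) y∈xs =
    M , All.zipWith (λ (u~w , u≢y , w≢y) → u~w , kept u≢y w≢y) (adj , All-ends⁻ M y∉M) , p
    where
    y∉M : All (_≢ y) (ends M)
    y∉M = All.map ≢-sym (All.¬Any⇒All¬ _ (disjoint-++ (spanning⇒unique p) y∈xs))
    kept : ∀ {u w} → u ≢ y → w ≢ y → ¬ Has [ (y , z) ] u w
    kept u≢y w≢y (inj₁ (here refl)) = u≢y refl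
    kept u≢y w≢y (inj₂ (here refl)) = w≢y refl

  -- If two of the three pairs were non-adjacent, the triple would be independent in `G`, or become
  -- so on deleting its only edge. Both the given matching and one missing only an end of that edge
  -- survive the deletion.
  edgeStable⇒triangle : ∀ {G : Graph (Fin n)} → FactorCritical G → EdgeStableEquimatchable G →
    ∀ {x y z} → Leaves (Adj G) (x ∷ y ∷ z ∷ []) → ¬ Adj G x y → Adj G x z × Adj G y z
  edgeStable⇒triangle {G} critical (equi , stable) L x≁y =
    decidable-stable (_ ~? _) (λ x≁z → two-edges L x≁y x≁z) ,
    decidable-stable (_ ~? _) (λ y≁z → two-edges (move (1 ∷ 0 ∷ []) L) (x≁y ∘ ~-sym) y≁z)
    where
    open Graph G
    two-edges : ∀ {x y z} → Leaves _~_ (x ∷ y ∷ z ∷ []) → ¬ x ~ y → ¬ x ~ z → ⊥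
    two-edges {x} {y} {z} L x≁y x≁z with y ~? z
    ... | no y≁z  = equimatchable⇒no-independent-triple {G} equi L
                      (factorCritical⇒leaves {G} critical y)
                      (triple-independent G x≁y x≁z y≁z)
    ... | yes y~z = equimatchable⇒no-independent-triple {G ∖ [ (y , z) ]} (stable y z y~z)
                      (leaves-∖ G z L (there (here refl)))
                      (leaves-∖ G z (factorCritical⇒leaves {G} critical y) (here refl))
                      (triple-independent (G ∖ [ (y , z) ]) (x≁y ∘ proj₁) (x≁z ∘ proj₁)
                        (λ (_ , kept) → kept (inj₁ (here refl))))

-- Counting ends of matching edges on the two sides of a partition

module _ {n : ℕ} (S : Subset n) where

  -- Throughout, `true` stands for `S` and `false` for its complement. The full table lets `count`
  -- compute once a value of `lookup S` is known.
  weight : Bool → Bool → ℕ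
  weight true  true  = 1
  weight true  false = 0
  weight false true  = 0
  weight false false = 1

  count : Bool → List (Fin n) → ℕ
  count b xs = sum (map (λ x → weight b (lookup S x)) xs)

  Inside : Bool → Fin n × Fin n → Set
  Inside b (u , w) = lookup S u ≡ b × lookup S w ≡ b

  inside? : ∀ b e → Dec (Inside b e)
  inside? b (u , w) = (lookup S u Bool.≟ b) ×-dec (lookup S w Bool.≟ b)

  -- Counts are invariant under permutation, and `U` lies entirely on side `b`.
  count-all : ∀ b {U xs} → All (λ u → lookup S u ≡ b) U → U ++ xs ↭ allFin n →
              count b (allFin n) ≡ length U + count b xs ×
              count (not b) (allFin n) ≡ count (not b) xs
  count-all b {U} {xs} U⊆b p = trans (sym (invariant b)) (same b U⊆b)
                             , trans (sym (invariant (not b))) (other b U⊆b)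
    where
    invariant : ∀ c → count c (U ++ xs) ≡ count c (allFin n)
    invariant c = sum-↭ (map⁺ (λ x → weight c (lookup S x)) p)
    same : ∀ b {U} → All (λ u → lookup S u ≡ b) U → count b (U ++ xs) ≡ length U + count b xs
    same b     []                     = refl
    same true  (eq ∷ eqs) rewrite eq  = cong suc (same true eqs)
    same false (eq ∷ eqs) rewrite eq  = cong suc (same false eqs)
    other : ∀ b {U} → All (λ u → lookup S u ≡ b) U → count (not b) (U ++ xs) ≡ count (not b) xs
    other b     []                    = refl
    other true  (eq ∷ eqs) rewrite eq = other true eqs
    other false (eq ∷ eqs) rewrite eq = other false eqs

  -- An edge with an end on the other side adds at least as much to the right as to the left. The
  -- slack `k` is 0 or 2 in the uses below.
  count-edge : ∀ b e {k xs ys} → ¬ Inside b e → count b xs ≤ k + count (not b) ys →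
    count b (proj₁ e ∷ proj₂ e ∷ xs) ≤ k + count (not b) (proj₁ e ∷ proj₂ e ∷ ys)
  count-edge b (u , w) {k} {_} {ys} outside le with lookup S u | lookup S w | b
  ... | true  | true  | true  = contradiction (refl , refl) outside
  ... | false | false | false = contradiction (refl , refl) outside
  ... | true  | true  | false = ≤-trans le (+-monoʳ-≤ k (m≤n+m _ 2))
  ... | false | false | true  = ≤-trans le (+-monoʳ-≤ k (m≤n+m _ 2))
  ... | true  | false | true  = ≤-trans (s≤s le) (≤-reflexive (sym (+-suc k _)))
  ... | true  | false | false = ≤-trans (s≤s le) (≤-reflexive (sym (+-suc k _)))
  ... | false | true  | true  = ≤-trans (s≤s le) (≤-reflexive (sym (+-suc k _)))
  ... | false | true  | false = ≤-trans (s≤s le) (≤-reflexive (sym (+-suc k _)))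

  count-bipartite : ∀ b {M} → All (λ e → ¬ Inside b e) M →
                    count b (ends M) ≤ count (not b) (ends M)
  count-bipartite b []                       = z≤n
  count-bipartite b {e ∷ M} (outside ∷ rest) =
    count-edge b e {0} {ends M} {ends M} outside (count-bipartite b rest)

  -- The slack 2 pays for the two ends of the only edge inside side `b`; after that edge
  -- `count-bipartite` applies.
  count-one-inside : ∀ b {M} → AllPairs (λ e f → ¬ (Inside b e × Inside b f)) M →
                     count b (ends M) ≤ 2 + count (not b) (ends M)
  count-one-inside b []                       = z≤n
  count-one-inside b {e@(u , w) ∷ M} (alone ∷ rest) with inside? b e
  ... | no outside = count-edge b e {2} {ends M} {ends M} outside (count-one-inside b rest)
  ... | yes (u∈b , w∈b)
    with count-bipartite b (All.map (λ not-both inside → not-both ((u∈b , w∈b) , inside)) alone)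
  ...   | le rewrite u∈b | w∈b with b
  ...     | true  = s≤s (s≤s le)
  ...     | false = s≤s (s≤s le)

-- Membership in the second family from a decidable set of vertices

module _ {n : ℕ} {P : Pred (Fin n) 0ℓ} (P? : Unary.Decidable P) where

  separate : Subset n
  separate = tabulate (λ u → does (P? u))

  private
    lookup-separate : ∀ u → lookup separate u ≡ does (P? u)
    lookup-separate = lookup∘tabulate (λ u → does (P? u))

  lookup-yes : ∀ {u} → P u → lookup separate u ≡ true
  lookup-yes {u} p = trans (lookup-separate u) (dec-true (P? u) p)

  lookup-no : ∀ {u} → ¬ P u → lookup separate u ≡ false
  lookup-no {u} ¬p = trans (lookup-separate u) (dec-false (P? u) ¬p)

  separate⁺ : ∀ {u} → P u → u Subset.∈ separate
  separate⁺ {u} p = lookup⇒[]= u separate (lookup-yes p)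

  separate⁻ : ∀ {u} → u Subset.∈ separate → P u
  separate⁻ {u} u∈ with P? u | trans (sym (lookup-separate u)) ([]=⇒lookup u∈)
  ... | yes p | _ = p

  separate-true : ∀ {u} → lookup separate u ≡ true → P u
  separate-true {u} eq = separate⁻ (lookup⇒[]= u separate eq)

  separate-false : ∀ {u} → lookup separate u ≡ false → ¬ P u
  separate-false eq p with trans (sym eq) ([]=⇒lookup (separate⁺ p))
  ... | ()

  at-least-three : ∀ {x y z} → P x → P y → P z → x ≢ y → x ≢ z → y ≢ z → 3 ≤ ∣ separate ∣
  at-least-three px py pz x≢y x≢z y≢z = ≤-trans
    (s≤s (≤-trans (s≤s (≤-trans (s≤s z≤n) (x∈p⇒∣p-x∣<∣p∣ z∈))) (x∈p⇒∣p-x∣<∣p∣ y∈)))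
    (x∈p⇒∣p-x∣<∣p∣ (separate⁺ px))
    where
    y∈ = x∈p∧x≢y⇒x∈p-y (separate⁺ py) (≢-sym x≢y)
    z∈ = x∈p∧x≢y⇒x∈p-y (x∈p∧x≢y⇒x∈p-y (separate⁺ pz) (≢-sym x≢z)) (≢-sym y≢z)

  -- Matching number 1 outside the set is split into an edge `pq` and the absence of two disjoint
  -- edges.
  𝒢₂-intro : (G : Graph (Fin n)) →
    (∀ {u w} → P u → P w → ¬ Adj G u w) →
    (∀ {u w} → P u → ¬ P w → Adj G u w) →
    (∃[ x ] ∃[ y ] ∃[ z ] (P x × P y × P z × x ≢ y × x ≢ z × y ≢ z)) →
    (∃[ p ] ∃[ q ] (¬ P p × ¬ P q × Adj G p q)) →
    (∀ {p q s t} → ¬ P p → ¬ P q → ¬ P s → ¬ P t → Adj G p q → Adj G s t →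
      ¬ Disjoint (p , q) (s , t)) →
    𝒢₂ G
  𝒢₂-intro G independent join (x , y , z , px , py , pz , x≢y , x≢z , y≢z)
           (p , q , ¬p , ¬q , p~q) no-two =
    separate ,
    (λ u w u∈ w∈ → independent (separate⁻ u∈) (separate⁻ w∈)) ,
    at-least-three px py pz x≢y x≢z y≢z ,
    (λ u w u∈ w∉ → join (separate⁻ u∈) (w∉ ∘ separate⁺)) ,
    ((((p , ¬p ∘ separate⁻) , (q , ¬q ∘ separate⁻)) ∷ [] , (p~q ∷ [] , [] ∷ []) , refl) , at-most-one)
    where
    at-most-one : ∀ M → IsMatching (G ─ (Subset._∈ separate)) M → length M ≤ 1
    at-most-one []          _ = z≤n
    at-most-one (_ ∷ [])    _ = s≤s z≤n
    at-most-one (((a , a∉) , (b , b∉)) ∷ ((c , c∉) , (d , d∉)) ∷ M)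
                ((a~b ∷ c~d ∷ _) , (((a≢c , a≢d , b≢c , b≢d) ∷ _) ∷ _)) =
      contradiction
        ((a≢c ∘ lift) , (a≢d ∘ lift) , (b≢c ∘ lift) , (b≢d ∘ lift))
        (no-two (a∉ ∘ separate⁺) (b∉ ∘ separate⁺) (c∉ ∘ separate⁺) (d∉ ∘ separate⁺) a~b c~d)
      where
      lift : ∀ {u w : Σ[ u ∈ Fin n ] ¬ u Subset.∈ separate} → proj₁ u ≡ proj₁ w → u ≡ w
      lift refl = refl

-- Exchanges around a vertex with non-neighbours

module Structure {n : ℕ} (G : Graph (Fin n))
  (triangle : ∀ {x y z} → Leaves (Adj G) (x ∷ y ∷ z ∷ []) →
              ¬ Adj G x y → Adj G x z × Adj G y z)
  (leaves : ∀ v → Leaves (Adj G) [ v ]) (7≤n : 7 ≤ n)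
  where
  open Graph G

  separated : ∀ {v x y} → v ~ x → ¬ v ~ y → x ≢ y
  separated v~x v≁y refl = v≁y v~x

  away : ∀ {v x y} → v ~ x → ¬ v ~ y → y ≢ x
  away v~x v≁y refl = v≁y v~x

  not-v : ∀ {v x y} → x ~ y → ¬ v ~ y → x ≢ v
  not-v x~y v≁y refl = v≁y x~y

  -- This is why every edge of a matching missing only `v` meets the neighbourhood of `v`.
  nonneighbour-partner : ∀ {v a a′} → Leaves _~_ (v ∷ a ∷ a′ ∷ []) → ¬ v ~ a → v ~ a′
  nonneighbour-partner L v≁a = proj₁ (triangle L v≁a)

  -- In the following modules a matching of G consists of the edges aa′, bb′, …
  -- and of edges elsewhere, and v is the only vertex it misses.

  module TwoNonneighbours {v a a′ b b′} (L : Leaves _~_ (v ∷ a ∷ a′ ∷ b ∷ b′ ∷ []))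
    (a~a′ : a ~ a′) (b~b′ : b ~ b′) (v≁a : ¬ v ~ a) (v≁b : ¬ v ~ b) where

    v~a′ : v ~ a′
    v~a′ = nonneighbour-partner (match b~b′ (move (3 ∷ 4 ∷ []) L)) v≁a

    v~b′ : v ~ b′
    v~b′ = nonneighbour-partner (match a~a′ (move (1 ∷ 2 ∷ []) L)) v≁b

    -- Exchanging `aa′` and `bb′` for `a′b′` would miss `v`, `a`, `b`, with `v` adjacent to neither
    -- of the others.
    a′≁b′ : ¬ a′ ~ b′
    a′≁b′ a′~b′ = v≁b (proj₁ (triangle (match a′~b′ (move (2 ∷ 4 ∷ []) L)) v≁a))

    -- With `va′` in place of `aa′` and `bb′`, the vertices `a`, `b`, `b′` are missed; with `vb′`
    -- they are `b`, `a`, `a′`.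
    cross : ¬ a ~ b → a ~ b′ × b ~ a′
    cross a≁b =
      proj₁ (triangle (match v~a′ (move (0 ∷ 2 ∷ 1 ∷ 3 ∷ 4 ∷ []) L)) a≁b) ,
      proj₁ (triangle (match v~b′ (move (0 ∷ 4 ∷ 3 ∷ 1 ∷ 2 ∷ []) L)) (a≁b ∘ ~-sym))

  module NeighbourEdge {v a a′ b b′ x y}
    (L : Leaves _~_ (v ∷ a ∷ a′ ∷ b ∷ b′ ∷ x ∷ y ∷ []))
    (a~a′ : a ~ a′) (b~b′ : b ~ b′) (x~y : x ~ y)
    (v≁a : ¬ v ~ a) (v≁b : ¬ v ~ b) (v~x : v ~ x) (v~y : v ~ y) where

    open TwoNonneighbours (match x~y (move (5 ∷ 6 ∷ []) L)) a~a′ b~b′ v≁a v≁b public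

    -- Matching `xa′` and `yb′` would again miss `v`, `a`, `b`.
    no-crossing : x ~ a′ → ¬ y ~ b′
    no-crossing x~a′ y~b′ =
      v≁b (proj₁ (triangle (match y~b′ (match x~a′ (move (5 ∷ 2 ∷ 6 ∷ 4 ∷ []) L))) v≁a))

    -- Given `ab`, match it and also `vy` or `vx`. The missed triples are `a′`, `b′`, `x` and `a′`,
    -- `b′`, `y`; as `a′b′` is absent, both edges excluded by `no-crossing` appear.
    a≁b : ¬ a ~ b
    a≁b a~b = no-crossing
      (~-sym (proj₁ (triangle (match v~y (match a~b
        (move (1 ∷ 3 ∷ 0 ∷ 6 ∷ 2 ∷ 4 ∷ 5 ∷ []) L))) a′≁b′)))
      (~-sym (proj₂ (triangle (match v~x (match a~b
        (move (1 ∷ 3 ∷ 0 ∷ 5 ∷ 2 ∷ 4 ∷ 6 ∷ []) L))) a′≁b′)))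

  -- Without `ab`, `cross` applies. With `ab` and `bc`, matching `bc` and `va′` misses `b′`, `c′`,
  -- `a`. With `ab` but not `bc`, there are edges `bc′` and `ca′`, and matching these misses `v`,
  -- `a`, `b′`.
  three-nonneighbours : ∀ {v a a′ b b′ c c′} →
    Leaves _~_ (v ∷ a ∷ a′ ∷ b ∷ b′ ∷ c ∷ c′ ∷ []) → a ~ a′ → b ~ b′ → c ~ c′ →
    ¬ v ~ a → ¬ v ~ b → ¬ v ~ c → a ~ b′
  three-nonneighbours {v} {a} {a′} {b} {b′} {c} {c′} L a~a′ b~b′ c~c′ v≁a v≁b v≁c
    with a ~? b | b ~? c
  ... | no a≁b  | _       = proj₁ (AB.cross a≁b)
    where module AB = TwoNonneighbours (match c~c′ (move (5 ∷ 6 ∷ []) L)) a~a′ b~b′ v≁a v≁b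
  ... | yes _   | yes b~c =
    ~-sym (proj₁ (triangle (match AB.v~a′ (match b~c
      (move (3 ∷ 5 ∷ 0 ∷ 2 ∷ 4 ∷ 6 ∷ []) L))) BC.a′≁b′))
    where
    module AB = TwoNonneighbours (match c~c′ (move (5 ∷ 6 ∷ []) L)) a~a′ b~b′ v≁a v≁b
    module BC = TwoNonneighbours (match a~a′ (move (1 ∷ 2 ∷ []) L)) b~b′ c~c′ v≁b v≁c
  ... | yes a~b | no b≁c  =
    proj₂ (triangle (match c~a′ (match b~c′ (move (3 ∷ 6 ∷ 5 ∷ 2 ∷ []) L))) v≁a)
    where
    module AB = TwoNonneighbours (match c~c′ (move (5 ∷ 6 ∷ []) L)) a~a′ b~b′ v≁a v≁b
    module BC = TwoNonneighbours (match a~a′ (move (1 ∷ 2 ∷ []) L)) b~b′ c~c′ v≁b v≁c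
    b~c′ : b ~ c′
    b~c′ = proj₁ (BC.cross b≁c)
    c~a′ : c ~ a′
    c~a′ = ~-sym (proj₁ (triangle (match BC.v~b′ (match a~b
      (move (1 ∷ 3 ∷ 0 ∷ 6 ∷ 2 ∷ 4 ∷ 5 ∷ []) L))) AB.a′≁b′))

  -- Matching `ab`, `cd` and `vd′` would miss `a′`, `b′`, `c′`, where `a′` is adjacent to neither of
  -- the others.
  no-disjoint-nonneighbour-edges : ∀ {v a a′ b b′ c c′ d d′} →
    Leaves _~_ (v ∷ a ∷ a′ ∷ b ∷ b′ ∷ c ∷ c′ ∷ d ∷ d′ ∷ []) →
    a ~ a′ → b ~ b′ → c ~ c′ → d ~ d′ →
    ¬ v ~ a → ¬ v ~ b → ¬ v ~ c → ¬ v ~ d → a ~ b → ¬ c ~ d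
  no-disjoint-nonneighbour-edges L a~a′ b~b′ c~c′ d~d′ v≁a v≁b v≁c v≁d a~b c~d =
    AC.a′≁b′ (proj₁ (triangle (match CD.v~b′ (match c~d (match a~b
      (move (1 ∷ 3 ∷ 5 ∷ 7 ∷ 0 ∷ 8 ∷ []) L)))) AB.a′≁b′))
    where
    module AB = TwoNonneighbours
      (match d~d′ (match c~c′ (move (5 ∷ 6 ∷ 7 ∷ 8 ∷ []) L))) a~a′ b~b′ v≁a v≁b
    module AC = TwoNonneighbours
      (match d~d′ (match b~b′ (move (3 ∷ 4 ∷ 7 ∷ 8 ∷ []) L))) a~a′ c~c′ v≁a v≁c
    module CD = TwoNonneighbours
      (match b~b′ (match a~a′ (move (1 ∷ 2 ∷ 3 ∷ 4 ∷ []) L))) c~c′ d~d′ v≁c v≁d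

  -- The argument for `a≁b` with the edges `az` and `bw` in place of `ab`.
  one-neighbour-edge : ∀ {v a a′ b b′ x y z w} →
    Leaves _~_ (v ∷ a ∷ a′ ∷ b ∷ b′ ∷ x ∷ y ∷ z ∷ w ∷ []) →
    a ~ a′ → b ~ b′ → x ~ y → z ~ w → ¬ v ~ a → ¬ v ~ b → v ~ x → v ~ y →
    a ~ z → ¬ b ~ w
  one-neighbour-edge L a~a′ b~b′ x~y z~w v≁a v≁b v~x v~y a~z b~w = no-crossing
    (~-sym (proj₁ (triangle (match b~w (match a~z (match v~y
      (move (0 ∷ 6 ∷ 1 ∷ 7 ∷ 3 ∷ 8 ∷ 2 ∷ 4 ∷ 5 ∷ []) L)))) a′≁b′)))
    (~-sym (proj₂ (triangle (match b~w (match a~z (match v~x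
      (move (0 ∷ 5 ∷ 1 ∷ 7 ∷ 3 ∷ 8 ∷ 2 ∷ 4 ∷ 6 ∷ []) L)))) a′≁b′)))
    where
    open NeighbourEdge (match z~w (move (7 ∷ 8 ∷ []) L)) a~a′ b~b′ x~y v≁a v≁b v~x v~y

  -- Two configurations that lead to the second family

  -- If a matching missing only `v` consists of such edges, then each of them has exactly one end in
  -- the neighbourhood of `v`, by `nonneighbour-partner`.
  Lopsided : Fin n → Rel (Fin n) 0ℓ
  Lopsided v u w = u ~ w × ¬ (v ~ u × v ~ w)

  Lopsided-sym : ∀ {v} → Symmetric (Lopsided v)
  Lopsided-sym (u~w , not-both) = ~-sym u~w , λ (p , q) → not-both (q , p)

  -- Here S is the neighbourhood of v.
  module LopsidedBase {v} (L₀ : Leaves (Lopsided v) [ v ]) where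

    plain : ∀ {xs} → Leaves (Lopsided v) xs → Leaves _~_ xs
    plain = weaken proj₁

    -- The edge is turned so that its non-neighbour of `v` comes first.
    next : ∀ {xs} → Leaves (Lopsided v) xs → length xs < n →
           ∃[ a ] ∃[ b ] (a ~ b × ¬ v ~ a × Leaves (Lopsided v) (a ∷ b ∷ xs))
    next L small with nonempty L small
    ... | u , w , (u~w , not-both) , L′ with v ~? u
    ...   | no v≁u  = u , w , u~w , v≁u , L′
    ...   | yes v~u = w , u , ~-sym u~w , (λ v~w → not-both (v~u , v~w)) , move (1 ∷ 0 ∷ []) L′

    -- The partners of `u` and `w` are non-neighbours of `v`, so `u` and `w` act as `a′` and `b′` in
    -- `TwoNonneighbours`.
    neighbours-independent : ∀ {u w} → v ~ u → v ~ w → ¬ u ~ w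
    neighbours-independent v~u v~w u~w
      with u′ , (u~u′ , not-both) , L₁ ← partner Lopsided-sym L₀ (≢-sym (adjacent⇒≢ G v~u) ∷ [])
      with v≁u′ ← (λ v~u′ → not-both (v~u , v~u′))
      with w′ , (w~w′ , not-both′) , L₂ ← partner Lopsided-sym L₁
             (≢-sym (adjacent⇒≢ G u~w) ∷ separated v~w v≁u′ ∷ ≢-sym (adjacent⇒≢ G v~w) ∷ [])
      = a′≁b′ u~w
      where open TwoNonneighbours (plain (move (4 ∷ 3 ∷ 2 ∷ 1 ∷ []) L₂)) (~-sym u~u′) (~-sym w~w′)
                   v≁u′ (λ v~w′ → not-both′ (v~w , v~w′))

    join : ∀ {u w} → v ~ u → ¬ v ~ w → u ~ w
    join {u} {w} v~u v≁w with w Fin.≟ v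
    ... | yes refl = ~-sym v~u
    ... | no w≢v with partner Lopsided-sym L₀ (≢-sym (adjacent⇒≢ G v~u) ∷ [])
    ...   | u′ , (u~u′ , not-both) , L₁ with w Fin.≟ u′
    ...     | yes refl = u~u′
    ...     | no w≢u′ with partner Lopsided-sym L₁ (away v~u v≁w ∷ w≢u′ ∷ w≢v ∷ [])
    -- `three-nonneighbours` needs a third matching edge; it exists because only five of at least
    -- seven vertices are listed.
    ...       | w′ , (w~w′ , _) , L₂ with next L₂ (≤-trans (m≤n+m 6 1) 7≤n)
    ...         | c , c′ , c~c′ , v≁c , L₃ = ~-sym (three-nonneighbours
      (plain (move (6 ∷ 2 ∷ 3 ∷ 5 ∷ 4 ∷ []) L₃)) w~w′ (~-sym u~u′) c~c′
      v≁w (λ v~u′ → not-both (v~u , v~u′)) v≁c)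

    three-neighbours : ∃[ x ] ∃[ y ] ∃[ z ] (v ~ x × v ~ y × v ~ z × x ≢ y × x ≢ z × y ≢ z)
    three-neighbours
      with a , a′ , a~a′ , v≁a , L₁ ← next L₀ (≤-trans (m≤n+m 2 5) 7≤n)
      with b , b′ , b~b′ , v≁b , L₂ ← next L₁ (≤-trans (m≤n+m 4 3) 7≤n)
      with c , c′ , c~c′ , v≁c , L₃@(_ , _ , p) ← next L₂ (≤-trans (m≤n+m 6 1) 7≤n)
      with _ ∷ (_ ∷ c′≢b′ ∷ _ ∷ c′≢a′ ∷ _) ∷ _ ∷ (_ ∷ b′≢a′ ∷ _) ∷ _ ← spanning⇒unique p
      = a′ , b′ , c′ , AB.v~a′ , AB.v~b′ , BC.v~b′ , ≢-sym b′≢a′ , ≢-sym c′≢a′ , ≢-sym c′≢b′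
      where
      module AB = TwoNonneighbours
        (match c~c′ (plain (move (0 ∷ 1 ∷ 6 ∷ 4 ∷ 5 ∷ []) L₃))) a~a′ b~b′ v≁a v≁b
      module BC = TwoNonneighbours
        (match a~a′ (plain (move (4 ∷ 5 ∷ 6 ∷ 2 ∷ 3 ∷ []) L₃))) b~b′ c~c′ v≁b v≁c

    S : Subset n
    S = separate (v ~?_)

    -- The lopsided matching missing `v` shows that `S` is smaller than its complement. Were the
    -- complement independent, a matching missing a vertex of `S` would show the opposite.
    nonneighbour-edge : ∃[ p ] ∃[ q ] (¬ v ~ p × ¬ v ~ q × p ~ q)
    nonneighbour-edge
      with Fin.any? (λ p → Fin.any? (λ q → ¬? (v ~? p) ×-dec ¬? (v ~? q) ×-dec (p ~? q)))
    ... | yes found = found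
    ... | no  none  = contradiction impossible (<-irrefl refl)
      where
      w : Fin n
      w = proj₁ three-neighbours
      v~w : v ~ w
      v~w = proj₁ (proj₂ (proj₂ (proj₂ three-neighbours)))
      M N : Edges (Fin n)
      M = proj₁ L₀
      N = proj₁ (leaves w)
      at-v : count S false (allFin n) ≡ 1 + count S false (ends M) ×
             count S true (allFin n) ≡ count S true (ends M)
      at-v = count-all S false (lookup-no (v ~?_) (irrefl refl) ∷ []) (proj₂ (proj₂ L₀))
      at-w : count S true (allFin n) ≡ 1 + count S true (ends N) ×
             count S false (allFin n) ≡ count S false (ends N)
      at-w = count-all S true (lookup-yes (v ~?_) v~w ∷ []) (proj₂ (proj₂ (leaves w)))
      impossible : count S true (allFin n) < count S true (allFin n)
      impossible = begin-strict
        count S true (allFin n)        ≡⟨ proj₂ at-v ⟩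
        count S true (ends M)          ≤⟨ count-bipartite S true (All.map
          (λ (_ , not-both) (p , q) → not-both (separate-true (v ~?_) p , separate-true (v ~?_) q))
          (proj₁ (proj₂ L₀))) ⟩
        count S false (ends M)         <⟨ n<1+n _ ⟩
        1 + count S false (ends M)     ≡⟨ proj₁ at-v ⟨
        count S false (allFin n)       ≡⟨ proj₂ at-w ⟩
        count S false (ends N)         ≤⟨ count-bipartite S false (All.map
          (λ p~q (p , q) → none (_ , _ , separate-false (v ~?_) p , separate-false (v ~?_) q , p~q))
          (proj₁ (proj₂ (leaves w)))) ⟩
        count S true (ends N)          <⟨ n<1+n _ ⟩
        1 + count S true (ends N)      ≡⟨ proj₁ at-w ⟨
        count S true (allFin n)        ∎
        where open ≤-Reasoning

    -- The partners of `p`, `q`, `s`, `t` are neighbours of `v`, so the four vertices lie on four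
    -- different matching edges.
    no-two-nonneighbour-edges : ∀ {p q s t} → ¬ v ~ p → ¬ v ~ q → ¬ v ~ s → ¬ v ~ t →
      p ~ q → s ~ t → ¬ Disjoint (p , q) (s , t)
    no-two-nonneighbour-edges v≁p v≁q v≁s v≁t p~q s~t (p≢s , p≢t , q≢s , q≢t)
      with p′ , (p~p′ , _) , L₁ ← partner Lopsided-sym L₀ (not-v p~q v≁q ∷ [])
      with v~p′ ← nonneighbour-partner (plain (move (2 ∷ []) L₁)) v≁p
      with q′ , (q~q′ , _) , L₂ ← partner Lopsided-sym L₁
             (≢-sym (adjacent⇒≢ G p~q) ∷ away v~p′ v≁q ∷ not-v (~-sym p~q) v≁p ∷ [])
      with v~q′ ← TwoNonneighbours.v~b′ (plain (move (4 ∷ 2 ∷ 3 ∷ []) L₂)) p~p′ q~q′ v≁p v≁q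
      with s′ , (s~s′ , _) , L₃ ← partner Lopsided-sym L₂
             (≢-sym q≢s ∷ away v~q′ v≁s ∷ ≢-sym p≢s ∷ away v~p′ v≁s ∷ not-v s~t v≁t ∷ [])
      with v~s′ ← TwoNonneighbours.v~b′ (match q~q′ (plain (move (2 ∷ 3 ∷ 6 ∷ 4 ∷ 5 ∷ []) L₃)))
                    p~p′ s~s′ v≁p v≁s
      with t′ , (t~t′ , _) , L₄ ← partner Lopsided-sym L₃
             (≢-sym (adjacent⇒≢ G s~t) ∷ away v~s′ v≁t ∷ ≢-sym q≢t ∷ away v~q′ v≁t
              ∷ ≢-sym p≢t ∷ away v~p′ v≁t ∷ not-v (~-sym s~t) v≁s ∷ [])
      = no-disjoint-nonneighbour-edges
          (plain (move (8 ∷ 6 ∷ 7 ∷ 4 ∷ 5 ∷ 2 ∷ 3 ∷ []) L₄)) p~p′ q~q′ s~s′ t~t′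
          v≁p v≁q v≁s v≁t p~q s~t

    in-𝒢₂ : 𝒢₂ G
    in-𝒢₂ = 𝒢₂-intro (v ~?_) G neighbours-independent join three-neighbours nonneighbour-edge
      no-two-nonneighbour-edges

  -- Here S consists of v and its non-neighbours.
  module OneNeighbourEdge {v x y a b} (L₀ : Leaves (Lopsided v) (x ∷ y ∷ v ∷ []))
    (x~y : x ~ y) (v~x : v ~ x) (v~y : v ~ y)
    (v≁a : ¬ v ~ a) (v≁b : ¬ v ~ b) (a≢b : a ≢ b) (a≢v : a ≢ v) (b≢v : b ≢ v)
    (full : ∀ {c} → ¬ v ~ c → c ~ x × c ~ y) where

    plain : ∀ {xs} → Leaves (Lopsided v) xs → Leaves _~_ xs
    plain = weaken proj₁

    -- The partner of `c` is a neighbour of `v`, so `c` and `d` lie on different matching edges and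
    -- `NeighbourEdge.a≁b` applies.
    nonneighbours-independent : ∀ {c d} → ¬ v ~ c → ¬ v ~ d → ¬ c ~ d
    nonneighbours-independent v≁c v≁d c~d
      with c′ , (c~c′ , _) , L₁ ← partner Lopsided-sym L₀
             (away v~x v≁c ∷ away v~y v≁c ∷ not-v c~d v≁d ∷ [])
      with v~c′ ← nonneighbour-partner (match x~y (plain (move (2 ∷ 3 ∷ 4 ∷ []) L₁))) v≁c
      with d′ , (d~d′ , _) , L₂ ← partner Lopsided-sym L₁
             (≢-sym (adjacent⇒≢ G c~d) ∷ away v~c′ v≁d ∷ away v~x v≁d ∷ away v~y v≁d
              ∷ not-v (~-sym c~d) v≁c ∷ [])
      = NeighbourEdge.a≁b (plain (move (6 ∷ 2 ∷ 3 ∷ 0 ∷ 1 ∷ []) L₂))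
          c~c′ d~d′ x~y v≁c v≁d v~x v~y c~d

    -- In the general case the partner `u′` of `u` is a non-neighbour of `v`, hence not adjacent to
    -- `c`, and `cross` yields `cu`.
    join : ∀ {c u} → ¬ v ~ c → v ~ u → c ~ u
    join {c} {u} v≁c v~u with c Fin.≟ v | u Fin.≟ x | u Fin.≟ y
    ... | yes refl | _        | _        = v~u
    ... | no _     | yes refl | _        = proj₁ (full v≁c)
    ... | no _     | no _     | yes refl = proj₂ (full v≁c)
    ... | no c≢v   | no u≢x   | no u≢y
      with partner Lopsided-sym L₀ (u≢x ∷ u≢y ∷ ≢-sym (adjacent⇒≢ G v~u) ∷ [])
    ...   | u′ , (u~u′ , not-both) , L₁ with c Fin.≟ u′
    ...     | yes refl = ~-sym u~u′
    ...     | no c≢u′ with partner Lopsided-sym L₁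
                 (away v~u v≁c ∷ c≢u′ ∷ away v~x v≁c ∷ away v~y v≁c ∷ c≢v ∷ [])
    ...       | c′ , (c~c′ , _) , L₂ =
      proj₁ (cross (nonneighbours-independent v≁c v≁u′))
      where
      v≁u′ : ¬ v ~ u′
      v≁u′ v~u′ = not-both (v~u , v~u′)
      open NeighbourEdge (plain (move (6 ∷ 0 ∷ 1 ∷ 3 ∷ 2 ∷ []) L₂))
        c~c′ (~-sym u~u′) x~y v≁c v≁u′ v~x v~y

    -- Away from `x` and `y` the partners of `p` and `q` are non-neighbours of `v`, and `a′≁b′`
    -- excludes `pq`.
    touching : ∀ {p q} → v ~ p → v ~ q → p ~ q → p ≢ x → p ≢ y → q ≢ x → ¬ q ≢ y
    touching v~p v~q p~q p≢x p≢y q≢x q≢y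
      with p′ , (p~p′ , not-both) , L₁ ← partner Lopsided-sym L₀
             (p≢x ∷ p≢y ∷ ≢-sym (adjacent⇒≢ G v~p) ∷ [])
      with v≁p′ ← (λ v~p′ → not-both (v~p , v~p′))
      with q′ , (q~q′ , not-both′) , L₂ ← partner Lopsided-sym L₁
             (≢-sym (adjacent⇒≢ G p~q) ∷ separated v~q v≁p′ ∷ q≢x ∷ q≢y
              ∷ ≢-sym (adjacent⇒≢ G v~q) ∷ [])
      = NeighbourEdge.a′≁b′ (plain (move (6 ∷ 3 ∷ 2 ∷ 1 ∷ 0 ∷ []) L₂))
          (~-sym p~p′) (~-sym q~q′) x~y v≁p′ (λ v~q′ → not-both′ (v~q , v~q′)) v~x v~y p~q

    crossing : ∀ {q t} → v ~ q → v ~ t → q ≢ t → q ≢ x → q ≢ y → t ≢ x → t ≢ y → x ~ q → ¬ y ~ t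
    crossing v~q v~t q≢t q≢x q≢y t≢x t≢y
      with q′ , (q~q′ , not-both) , L₁ ← partner Lopsided-sym L₀
             (q≢x ∷ q≢y ∷ ≢-sym (adjacent⇒≢ G v~q) ∷ [])
      with v≁q′ ← (λ v~q′ → not-both (v~q , v~q′))
      with t′ , (t~t′ , not-both′) , L₂ ← partner Lopsided-sym L₁
             (≢-sym q≢t ∷ separated v~t v≁q′ ∷ t≢x ∷ t≢y ∷ ≢-sym (adjacent⇒≢ G v~t) ∷ [])
      = NeighbourEdge.no-crossing (plain (move (6 ∷ 3 ∷ 2 ∷ 1 ∷ 0 ∷ []) L₂))
          (~-sym q~q′) (~-sym t~t′) x~y v≁q′ (λ v~t′ → not-both′ (v~t , v~t′)) v~x v~y

    touches : ∀ {p q} → v ~ p → v ~ q → p ~ q → (p ≡ x ⊎ p ≡ y) ⊎ (q ≡ x ⊎ q ≡ y)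
    touches {p} {q} v~p v~q p~q
      with p Fin.≟ x | p Fin.≟ y | q Fin.≟ x | q Fin.≟ y
    ... | yes p≡x | _       | _       | _       = inj₁ (inj₁ p≡x)
    ... | no _    | yes p≡y | _       | _       = inj₁ (inj₂ p≡y)
    ... | no _    | no _    | yes q≡x | _       = inj₂ (inj₁ q≡x)
    ... | no _    | no _    | no _    | yes q≡y = inj₂ (inj₂ q≡y)
    ... | no p≢x  | no p≢y  | no q≢x  | no q≢y  =
      contradiction q≢y (touching v~p v~q p~q p≢x p≢y q≢x)

    -- Disjointness puts one edge at `x` and the other at `y`, which `crossing` excludes.
    no-two-anchored : ∀ {p q s t} → p ≡ x ⊎ p ≡ y → s ≡ x ⊎ s ≡ y → v ~ q → v ~ t →
      p ~ q → s ~ t → ¬ Disjoint (p , q) (s , t)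
    no-two-anchored (inj₁ refl) (inj₁ refl) _ _ _ _ (p≢s , _) = p≢s refl
    no-two-anchored (inj₂ refl) (inj₂ refl) _ _ _ _ (p≢s , _) = p≢s refl
    no-two-anchored (inj₁ refl) (inj₂ refl) v~q v~t x~q y~t (_ , x≢t , q≢y , q≢t) =
      crossing v~q v~t q≢t (≢-sym (adjacent⇒≢ G x~q)) q≢y
        (≢-sym x≢t) (≢-sym (adjacent⇒≢ G y~t)) x~q y~t
    no-two-anchored (inj₂ refl) (inj₁ refl) v~q v~t y~q x~t (_ , y≢t , q≢x , q≢t) =
      crossing v~t v~q (≢-sym q≢t) (≢-sym (adjacent⇒≢ G x~t)) (≢-sym y≢t)
        q≢x (≢-sym (adjacent⇒≢ G y~q)) x~t y~q

    no-two-neighbour-edges : ∀ {p q s t} → v ~ p → v ~ q → v ~ s → v ~ t →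
      p ~ q → s ~ t → ¬ Disjoint (p , q) (s , t)
    no-two-neighbour-edges v~p v~q v~s v~t p~q s~t (p≢s , p≢t , q≢s , q≢t)
      with touches v~p v~q p~q | touches v~s v~t s~t
    ... | inj₁ p∈ | inj₁ s∈ =
      no-two-anchored p∈ s∈ v~q v~t p~q s~t (p≢s , p≢t , q≢s , q≢t)
    ... | inj₁ p∈ | inj₂ t∈ =
      no-two-anchored p∈ t∈ v~q v~s p~q (~-sym s~t) (p≢t , p≢s , q≢t , q≢s)
    ... | inj₂ q∈ | inj₁ s∈ =
      no-two-anchored q∈ s∈ v~p v~t (~-sym p~q) s~t (q≢s , q≢t , p≢s , p≢t)
    ... | inj₂ q∈ | inj₂ t∈ =
      no-two-anchored q∈ t∈ v~p v~s (~-sym p~q) (~-sym s~t) (q≢t , q≢s , p≢t , p≢s)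

    in-𝒢₂ : 𝒢₂ G
    in-𝒢₂ = 𝒢₂-intro (λ u → ¬? (v ~? u)) G nonneighbours-independent
      (λ v≁c ¬v≁u → join v≁c (neighbour ¬v≁u))
      (v , a , b , irrefl refl , v≁a , v≁b , ≢-sym a≢v , ≢-sym b≢v , a≢b)
      (x , y , (λ v≁x → v≁x v~x) , (λ v≁y → v≁y v~y) , x~y)
      (λ ¬p ¬q ¬s ¬t → no-two-neighbour-edges (neighbour ¬p) (neighbour ¬q) (neighbour ¬s) (neighbour ¬t))
      where
      neighbour : ∀ {u} → ¬ ¬ v ~ u → v ~ u
      neighbour {u} = decidable-stable (v ~? u)

  -- Changing the base vertex

  -- With `c′` the partner of `c`, adding `vc′` and `xy` gives a matching that misses only `c`, and
  -- neither edge lies in the neighbourhood of `c`. Another edge `zw` there would make `v` and `x`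
  -- non-adjacent by `NeighbourEdge.a≁b` based at `c`; so the matching is lopsided for `c`.
  rebase : ∀ {v x y c} → Leaves _~_ (x ∷ y ∷ v ∷ []) → x ~ y → v ~ x → v ~ y →
           ¬ v ~ c → ¬ c ~ x → 𝒢₂ G
  rebase {v} {x} {y} {c} L x~y v~x v~y v≁c c≁x
    with c′ , c~c′ , L₁ ← partner ~-sym L
           (away v~x v≁c ∷ away v~y v≁c ∷ (λ { refl → c≁x v~x }) ∷ [])
    with v~c′ ← nonneighbour-partner (match x~y (move (2 ∷ 3 ∷ 4 ∷ []) L₁)) v≁c
    with search (λ z w → (c ~? z) ×-dec (c ~? w)) L₁
  ... | inj₁ (z , w , z~w , (c~z , c~w) , L₂) = contradiction v~x
    (NeighbourEdge.a≁b (move (2 ∷ 6 ∷ 3 ∷ 4 ∷ 5 ∷ []) L₂) v~c′ x~y z~w (v≁c ∘ ~-sym) c≁x c~z c~w)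
  ... | inj₂ L₂ = LopsidedBase.in-𝒢₂
    (match (x~y , λ (c~x , _) → c≁x c~x)
      (match (v~c′ , λ (c~v , _) → v≁c (~-sym c~v)) (move (4 ∷ 1 ∷ 2 ∷ 3 ∷ []) L₂)))

  complete-or-rebase : ∀ {v x y} → Leaves _~_ (x ∷ y ∷ v ∷ []) → x ~ y → v ~ x → v ~ y →
    𝒢₂ G ⊎ (∀ {c} → ¬ v ~ c → c ~ x × c ~ y)
  complete-or-rebase {v} {x} {y} L x~y v~x v~y
    with Fin.any? (λ c → ¬? (v ~? c) ×-dec ¬? (c ~? x))
       | Fin.any? (λ c → ¬? (v ~? c) ×-dec ¬? (c ~? y))
  ... | yes (c , v≁c , c≁x) | _ = inj₁ (rebase L x~y v~x v~y v≁c c≁x)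
  ... | no _ | yes (c , v≁c , c≁y) =
    inj₁ (rebase (move (1 ∷ []) L) (~-sym x~y) v~y v~x v≁c c≁y)
  ... | no all-x | no all-y = inj₂ (λ {c} v≁c →
    decidable-stable (c ~? x) (λ c≁x → all-x (c , v≁c , c≁x)) ,
    decidable-stable (c ~? y) (λ c≁y → all-y (c , v≁c , c≁y)))

  two-nonneighbours⇒𝒢₂ : ∀ {v a b} → ¬ v ~ a → ¬ v ~ b → a ≢ b → a ≢ v → b ≢ v → 𝒢₂ G
  two-nonneighbours⇒𝒢₂ {v} {a} {b} v≁a v≁b a≢b a≢v b≢v
    with search (λ x y → (v ~? x) ×-dec (v ~? y)) (leaves v)
  ... | inj₂ L = LopsidedBase.in-𝒢₂ L
  ... | inj₁ (x , y , x~y , (v~x , v~y) , L) with complete-or-rebase L x~y v~x v~y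
  ...   | inj₁ done = done
  ...   | inj₂ full with search (λ z w → (v ~? z) ×-dec (v ~? w)) L
  ...     | inj₂ L₁ = OneNeighbourEdge.in-𝒢₂ L₁ x~y v~x v~y v≁a v≁b a≢b a≢v b≢v full
  ...     | inj₁ (z , w , z~w , (v~z , v~w) , L₁)
    with complete-or-rebase (match x~y (move (2 ∷ 3 ∷ []) L₁)) z~w v~z v~w
  ...       | inj₁ done  = done
  ...       | inj₂ full′
    with a′ , a~a′ , L₂ ← partner ~-sym L₁
           (away v~z v≁a ∷ away v~w v≁a ∷ away v~x v≁a ∷ away v~y v≁a ∷ a≢v ∷ [])
    with v~a′ ← nonneighbour-partner (match x~y (match z~w
           (move (2 ∷ 3 ∷ 4 ∷ 5 ∷ 6 ∷ []) L₂))) v≁a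
    with b′ , b~b′ , L₃ ← partner ~-sym L₂
           (≢-sym a≢b ∷ away v~a′ v≁b ∷ away v~z v≁b ∷ away v~w v≁b ∷ away v~x v≁b
            ∷ away v~y v≁b ∷ b≢v ∷ [])
    -- Two matching edges `xy` and `zw` among the neighbours of `v` cannot occur: `full′` supplies
    -- `az` and `bw`.
    = contradiction (proj₂ (full′ v≁b))
        (one-neighbour-edge (move (8 ∷ 2 ∷ 3 ∷ 0 ∷ 1 ∷ 6 ∷ 7 ∷ 4 ∷ 5 ∷ []) L₃)
          a~a′ b~b′ x~y z~w v≁a v≁b v~x v~y (proj₁ (full′ v≁a)))

-- The families are edge-stable

∉⇒false : ∀ {n} {S : Subset n} {u} → u Subset.∉ S → lookup S u ≡ false
∉⇒false {S = S} {u} u∉ = ¬-not (λ eq → u∉ (lookup⇒[]= u S eq))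

module _ {n : ℕ} (G : Graph (Fin n)) where
  open Graph G

  -- As `n` is odd, missing at most two vertices means missing exactly one, so every maximal
  -- matching has `r` edges.
  edgeStable-if : ∀ r → n ≡ 2 * r + 1 →
    (∀ U {M} → All (uncurry _~_) M → U ++ ends M ↭ allFin n → Sparse G U → length U ≤ 2) →
    EdgeStableEquimatchable G
  edgeStable-if r odd few = equimatchable G (λ e → e) sparse , λ u w u~w →
    equimatchable (G ∖ [ (u , w) ]) proj₁ (sparse-∖ u~w)
    where
    half : ∀ {u m} → u ≤ 2 → u + 2 * m ≡ 2 * r + 1 → m ≡ r
    half {m = m} z≤n             eq = ⊥-elim (even≢odd m r (trans eq (+-comm (2 * r) 1)))
    half {m = m} (s≤s z≤n)       eq = *-cancelˡ-≡ m r 2 (suc-injective (trans eq (+-comm (2 * r) 1)))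
    half {m = m} (s≤s (s≤s z≤n)) eq =
      ⊥-elim (even≢odd (suc m) r (trans (*-suc 2 m) (trans eq (+-comm (2 * r) 1))))

    equimatchable : ∀ (H : Graph (Fin n)) → (∀ {u w} → Adj H u w → u ~ w) →
      (∀ {U} → Independent H U → Sparse G U) → Equimatchable H
    equimatchable H H⊆G independent⇒sparse M N maxM maxN = trans (size maxM) (sym (size maxN))
      where
      size : ∀ {M} → IsMaximalMatching H M → length M ≡ r
      size {M} max@((adj , _) , _) with maximal⇒uncovered-independent H max
      ... | U , p , independent =
        half (few U (All.map H⊆G adj) p (independent⇒sparse independent)) (trans (sym (order U p)) odd)

    sparse : ∀ {U} → Independent G U → Sparse G U
    sparse independent x∈ y∈ _ _ x~y _ = independent x∈ y∈ x~y

    -- Two edges at `x` inside `U` would both have to be the deleted edge.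
    sparse-∖ : ∀ {u w} → u ~ w → ∀ {U} → Independent (G ∖ [ (u , w) ]) U → Sparse G U
    sparse-∖ u~w independent x∈ y∈ z∈ y≢z x~y x~z =
      independent x∈ y∈ (x~y , λ has-y → independent x∈ z∈ (x~z , λ has-z →
        y≢z (partner-unique G (u~w ∷ [] , [] ∷ []) has-y has-z)))

  NearlyComplete : Set
  NearlyComplete = ∀ {v a b} → ¬ v ~ a → ¬ v ~ b → a ≢ v → b ≢ v → a ≡ b

  -- Three missed vertices form three pairs, of which sparsity allows at most one edge and near
  -- completeness at most one non-edge.
  nearlyComplete⇒edgeStable : ∀ r → n ≡ 2 * r + 1 → NearlyComplete → EdgeStableEquimatchable G
  nearlyComplete⇒edgeStable r odd nearly = edgeStable-if r odd few
    where
    few : ∀ U {M} → All (uncurry _~_) M → U ++ ends M ↭ allFin n → Sparse G U → length U ≤ 2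
    few []                _ _ _ = z≤n
    few (_ ∷ [])          _ _ _ = s≤s z≤n
    few (_ ∷ _ ∷ [])      _ _ _ = s≤s (s≤s z≤n)
    few (x ∷ y ∷ z ∷ U) _ p sparse
      with (x≢y ∷ x≢z ∷ _) ∷ (y≢z ∷ _) ∷ _ ← spanning⇒unique p
      with x ~? y | x ~? z
    ... | yes x~y | yes x~z = contradiction x~z
      (sparse (here refl) (there (here refl)) (there (there (here refl))) y≢z x~y)
    ... | no x≁y  | no x≁z  = contradiction (nearly x≁y x≁z (≢-sym x≢y) (≢-sym x≢z)) y≢z
    ... | no x≁y  | yes x~z = ⊥-elim (sparse (there (there (here refl))) (here refl)
      (there (here refl)) x≢y (~-sym x~z) (decidable-stable (z ~? y) (λ z≁y →
        x≢z (nearly (x≁y ∘ ~-sym) (z≁y ∘ ~-sym) x≢y (≢-sym y≢z)))))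
    ... | yes x~y | no x≁z  = ⊥-elim (sparse (there (here refl)) (here refl)
      (there (there (here refl))) x≢z (~-sym x~y) (decidable-stable (y ~? z) (λ y≁z →
        x≢y (nearly (x≁z ∘ ~-sym) (y≁z ∘ ~-sym) x≢z y≢z))))

  -- Non-adjacency yields membership in `M` only up to double negation, which decidable equality of
  -- `a` and `b` absorbs.
  𝒢₁⇒nearlyComplete : 𝒢₁ G → NearlyComplete
  𝒢₁⇒nearlyComplete (r , _ , M , matching , _ , f , iso) {v} {a} {b} v≁a v≁b a≢v b≢v =
    decidable-stable (a Fin.≟ b) λ a≢b → removed v≁a a≢v λ has-a → removed v≁b b≢v λ has-b →
      a≢b (to-injective (partner-unique (K (2 * r + 1)) matching has-a has-b))
    where
    open Inverse f using (to; from; strictlyInverseʳ)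
    to-injective : ∀ {u w} → to u ≡ to w → u ≡ w
    to-injective {u} {w} eq =
      trans (sym (strictlyInverseʳ u)) (trans (cong from eq) (strictlyInverseʳ w))
    removed : ∀ {u w} → ¬ u ~ w → w ≢ u → ¬ ¬ Has M (to u) (to w)
    removed {u} {w} u≁w w≢u kept =
      u≁w (Equivalence.from (iso u w) ((λ eq → w≢u (sym (to-injective eq))) , kept))

  joint : ∀ {S : Subset n} → (∀ u w → u Subset.∈ S → w Subset.∉ S → u ~ w) →
          ∀ {u w} → lookup S u ≢ lookup S w → u ~ w
  joint {S} join {u} {w} differ with u Subset.∈? S | w Subset.∈? S
  ... | yes u∈ | no w∉  = join u w u∈ w∉
  ... | no u∉  | yes w∈ = ~-sym (join w u w∈ u∉)
  ... | yes u∈ | yes w∈ = contradiction (trans ([]=⇒lookup u∈) (sym ([]=⇒lookup w∈))) differ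
  ... | no u∉  | no w∉  = contradiction (trans (∉⇒false u∉) (sym (∉⇒false w∉))) differ

  𝒢₂⇒edgeStable : ∀ r → n ≡ 2 * r + 1 → (∀ v → Leaves _~_ [ v ]) → 𝒢₂ G →
                  EdgeStableEquimatchable G
  𝒢₂⇒edgeStable r odd leaves (S , independent , 3≤∣S∣ , join , (R-matching , at-most-one)) =
    edgeStable-if r odd few
    where
    ♯ : Bool → ℕ
    ♯ b = count S b (allFin n)

    no-inside-S : ∀ {M} → All (uncurry _~_) M → All (λ e → ¬ Inside S true e) M
    no-inside-S = All.map (λ {e} u~w (u∈ , w∈) →
      independent _ _ (lookup⇒[]= (proj₁ e) S u∈) (lookup⇒[]= (proj₂ e) S w∈) u~w)

    outside : ∀ {u} → lookup S u ≡ false → u Subset.∉ S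
    outside eq u∈ with trans (sym eq) ([]=⇒lookup u∈)
    ... | ()

    one-inside-R : ∀ {M} → All (uncurry _~_) M → AllPairs Disjoint M →
                   AllPairs (λ e f → ¬ (Inside S false e × Inside S false f)) M
    one-inside-R adj disj = AllPairs.map
      (λ { {u , w} {u′ , w′} (u~w , u′~w′ , a , b , c , d) ((p , q) , (p′ , q′)) →
        <-irrefl refl (at-most-one
          (((u , outside p) , (w , outside q)) ∷ ((u′ , outside p′) , (w′ , outside q′)) ∷ [])
          ( (u~w ∷ u′~w′ ∷ [])
          , ((a ∘ cong proj₁ , b ∘ cong proj₁ , c ∘ cong proj₁ , d ∘ cong proj₁) ∷ [])
            ∷ [] ∷ [])) })
      (AllPairs-with-All adj disj)

    S-in : ∃[ s ] s Subset.∈ S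
    S-in with Subset.nonempty? S
    ... | yes found = found
    ... | no  empty = contradiction
      (subst (3 ≤_) (trans (cong ∣_∣ (Subset.Empty-unique empty)) (Subset.∣⊥∣≡0 n)) 3≤∣S∣) λ ()

    R-in : ∃[ t ] t Subset.∉ S
    R-in = case R-matching of λ { (((t , _) ∷ _) , _ , _) → t }

    S<R : ♯ true < ♯ false
    S<R with leaves (proj₁ R-in)
    ... | M , adj , p with count-all S false (∉⇒false (proj₂ R-in) ∷ []) p
    ...   | R-eq , S-eq = begin-strict
      ♯ true                      ≡⟨ S-eq ⟩
      count S true (ends M)       ≤⟨ count-bipartite S true (no-inside-S adj) ⟩
      count S false (ends M)      <⟨ n<1+n _ ⟩
      1 + count S false (ends M)  ≡⟨ R-eq ⟨
      ♯ false                     ∎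
      where open ≤-Reasoning

    -- In a matching missing a vertex of `S`, at most one edge avoids `S`. With `S<R`, the
    -- complement has exactly one vertex more than `S`.
    R≤1+S : ♯ false ≤ 1 + ♯ true
    R≤1+S with leaves (proj₁ S-in)
    ... | M , adj , p with count-all S true ([]=⇒lookup (proj₂ S-in) ∷ []) p
    ...   | S-eq , R-eq = begin
      ♯ false                     ≡⟨ R-eq ⟩
      count S false (ends M)      ≤⟨ count-one-inside S false
        (one-inside-R adj (unique⇒disjoint M (unique-++ʳ [ _ ] (spanning⇒unique p)))) ⟩
      2 + count S true (ends M)   ≡⟨ cong suc S-eq ⟨
      1 + ♯ true                  ∎
      where open ≤-Reasoning

    -- The matching edges alone force nearly balanced sides, so the known difference of the sizes
    -- bounds `U`.
    one-sided : ∀ b {U M} → All (λ u → lookup S u ≡ b) U → All (uncurry _~_) M →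
                U ++ ends M ↭ allFin n → length U ≤ 1
    one-sided true {U} {M} U⊆S adj p with count-all S true U⊆S p
    ... | S-eq , R-eq = +-cancelʳ-≤ (1 + count S true (ends M)) (length U) 1 (begin
      length U + (1 + count S true (ends M))   ≡⟨ +-suc (length U) _ ⟩
      1 + (length U + count S true (ends M))   ≡⟨ cong suc S-eq ⟨
      1 + ♯ true                               ≤⟨ S<R ⟩
      ♯ false                                  ≡⟨ R-eq ⟩
      count S false (ends M)                   ≤⟨ count-one-inside S false
        (one-inside-R adj (unique⇒disjoint M (unique-++ʳ U (spanning⇒unique p)))) ⟩
      2 + count S true (ends M)                ∎)
      where open ≤-Reasoning
    one-sided false {U} {M} U⊆R adj p with count-all S false U⊆R p
    ... | R-eq , S-eq = +-cancelʳ-≤ (count S false (ends M)) (length U) 1 (begin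
      length U + count S false (ends M)        ≡⟨ R-eq ⟨
      ♯ false                                  ≤⟨ R≤1+S ⟩
      1 + ♯ true                               ≡⟨ cong suc S-eq ⟩
      1 + count S true (ends M)                ≤⟨ s≤s (count-bipartite S true (no-inside-S adj)) ⟩
      1 + count S false (ends M)               ∎)
      where open ≤-Reasoning

    -- A vertex of `U` on the other side would be joined to both `x` and `y`.
    same-side : ∀ {U x y} → Sparse G U → x ∈ U → y ∈ U → x ≢ y →
                lookup S x ≡ lookup S y → All (λ u → lookup S u ≡ lookup S x) U
    same-side {U} {x} {y} sparse x∈ y∈ x≢y x≈y = All.tabulate λ {u} u∈ →
      decidable-stable (lookup S u Bool.≟ lookup S x) λ u≉x →
        sparse u∈ x∈ y∈ x≢y (joint join u≉x) (joint join (λ u≈y → u≉x (trans u≈y (sym x≈y))))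

    few : ∀ U {M} → All (uncurry _~_) M → U ++ ends M ↭ allFin n → Sparse G U → length U ≤ 2
    few []           _ _ _ = z≤n
    few (_ ∷ [])     _ _ _ = s≤s z≤n
    few (_ ∷ _ ∷ []) _ _ _ = s≤s (s≤s z≤n)
    few U@(x ∷ y ∷ z ∷ _) adj p sparse
      with (x≢y ∷ x≢z ∷ _) ∷ (y≢z ∷ _) ∷ _ ← spanning⇒unique p
      with lookup S x Bool.≟ lookup S y | lookup S x Bool.≟ lookup S z
    ... | yes x≈y | _       = m≤n⇒m≤1+n (one-sided _
      (same-side sparse (here refl) (there (here refl)) x≢y x≈y) adj p)
    ... | no _    | yes x≈z = m≤n⇒m≤1+n (one-sided _
      (same-side sparse (here refl) (there (there (here refl))) x≢z x≈z) adj p)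
    -- There are only two sides, so `y` and `z` share the one that `x` is not on.
    ... | no x≉y  | no x≉z  = m≤n⇒m≤1+n (one-sided _
      (same-side sparse (there (here refl)) (there (there (here refl))) y≢z
        (trans (¬-not (≢-sym x≉y)) (sym (¬-not (≢-sym x≉z))))) adj p)

-- The complement as a removed matching

nearlyComplete⇒𝒢₁ : ∀ {n} (G : Graph (Fin n)) r → n ≡ 2 * r + 1 → 3 ≤ r → NearlyComplete G →
                    ¬ Complete G → 𝒢₁ G
nearlyComplete⇒𝒢₁ G r refl 3≤r nearly incomplete =
  r , 3≤r , M , (All.map Fin.<⇒≢ ordered , disjoint) , nonempty-M ,
  ↔-id _ , λ u w → mk⇔ (kept u w) (back u w)
  where
  open Graph G
  Missing : Fin (2 * r + 1) × Fin (2 * r + 1) → Set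
  Missing (u , w) = u Fin.< w × ¬ u ~ w

  missing? : Unary.Decidable Missing
  missing? (u , w) = (u Fin.<? w) ×-dec ¬? (u ~? w)

  pairs M : Edges (Fin (2 * r + 1))
  pairs = cartesianProduct (allFin _) (allFin _)
  M = filter missing? pairs

  missing : All Missing M
  missing = All.all-filter missing? pairs

  ordered : All (uncurry Fin._<_) M
  ordered = All.map proj₁ missing

  disjoint : AllPairs Disjoint M
  disjoint = AllPairs.map separate-pairs (AllPairs-with-All missing
    (Unique.filter⁺ missing? (Unique.cartesianProduct⁺ (Unique.allFin⁺ _) (Unique.allFin⁺ _))))
    where
    -- A shared vertex has a single non-neighbour, so the pairs coincide. In equal positions this
    -- contradicts `e ≢ f`, in opposite positions the order of the entries.
    separate-pairs : ∀ {e f} → Missing e × Missing f × e ≢ f → Disjoint e f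
    separate-pairs {a , b} {c , d} ((a<b , a≁b) , (c<d , c≁d) , e≢f) =
      (λ { refl → e≢f (cong (a ,_) (nearly a≁b c≁d (≢-sym (Fin.<⇒≢ a<b)) (≢-sym (Fin.<⇒≢ c<d)))) }) ,
      (λ { refl → Fin.<-asym a<b (subst (Fin._< a)
             (nearly (c≁d ∘ ~-sym) a≁b (Fin.<⇒≢ c<d) (≢-sym (Fin.<⇒≢ a<b))) c<d) }) ,
      (λ { refl → Fin.<-asym a<b (subst (b Fin.<_)
             (nearly c≁d (a≁b ∘ ~-sym) (≢-sym (Fin.<⇒≢ c<d)) (Fin.<⇒≢ a<b)) c<d) }) ,
      (λ { refl → e≢f (cong (_, b)
             (nearly (a≁b ∘ ~-sym) (c≁d ∘ ~-sym) (Fin.<⇒≢ a<b) (Fin.<⇒≢ c<d))) })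

  listed : ∀ {u w} → u ≢ w → ¬ u ~ w → Has M u w
  listed {u} {w} u≢w u≁w with Fin.<-cmp u w
  ... | tri< u<w _ _ = inj₁ (∈-filter⁺ missing?
    (∈-cartesianProduct⁺ (∈-allFin u) (∈-allFin w)) (u<w , u≁w))
  ... | tri≈ _ u≡w _ = contradiction u≡w u≢w
  ... | tri> _ _ w<u = inj₂ (∈-filter⁺ missing?
    (∈-cartesianProduct⁺ (∈-allFin w) (∈-allFin u)) (w<u , u≁w ∘ ~-sym))

  kept : ∀ u w → u ~ w → u ≢ w × ¬ Has M u w
  kept u w u~w = adjacent⇒≢ G u~w , λ where
    (inj₁ p) → proj₂ (All.lookup missing p) u~w
    (inj₂ p) → proj₂ (All.lookup missing p) (~-sym u~w)

  back : ∀ u w → u ≢ w × ¬ Has M u w → u ~ w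
  back u w (u≢w , unlisted) = decidable-stable (u ~? w) (unlisted ∘ listed u≢w)

  nonempty-M : M ≢ []
  nonempty-M M≡[] = incomplete λ u w u≢w → back u w (u≢w , subst (λ N → ¬ Has N u w) (sym M≡[]) λ where
    (inj₁ ())
    (inj₂ ()))

nearlyComplete-or-two-nonneighbours : ∀ {n} (G : Graph (Fin n)) → let open Graph G in
  NearlyComplete G ⊎
  (∃[ v ] ∃[ a ] ∃[ b ] (¬ v ~ a × ¬ v ~ b × a ≢ b × a ≢ v × b ≢ v))
nearlyComplete-or-two-nonneighbours G
  with Fin.any? (λ v → Fin.any? (λ a → Fin.any? (λ b →
         ¬? (v ~? a) ×-dec ¬? (v ~? b) ×-dec ¬? (a Fin.≟ b) ×-dec ¬? (a Fin.≟ v) ×-dec ¬? (b Fin.≟ v))))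
  where open Graph G
... | yes found = inj₂ found
... | no  none  = inj₁ (λ v≁a v≁b a≢v b≢v → decidable-stable (_ Fin.≟ _)
  (λ a≢b → none (_ , _ , _ , v≁a , v≁b , a≢b , a≢v , b≢v)))

-- The equivalence

theorem3p6 : (n : ℕ) (G : Graph (Fin n)) → FactorCritical G → 7 ≤ n →
    EdgeStableEquimatchable G ⇔ (OddComplete G ⊎ 𝒢₁ G ⊎ 𝒢₂ G)
theorem3p6 n@(suc _) G critical 7≤n = mk⇔ classify stable
  where
  open Graph G

  leaves : ∀ v → Leaves _~_ [ v ]
  leaves = factorCritical⇒leaves {G = G} critical

  r : ℕ
  -- Factor-criticality makes `n` odd: a matching missing only one vertex has `r` edges.
  r = length (proj₁ (leaves Fin.zero))

  odd : n ≡ 2 * r + 1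
  odd = trans (order [ Fin.zero ] (proj₂ (proj₂ (leaves Fin.zero)))) (+-comm 1 (2 * r))

  3≤r : 3 ≤ r
  3≤r = *-cancelˡ-≤ 2 (≤-pred (subst (7 ≤_) (trans odd (+-comm (2 * r) 1)) 7≤n))

  classify : EdgeStableEquimatchable G → OddComplete G ⊎ 𝒢₁ G ⊎ 𝒢₂ G
  classify ese with nearlyComplete-or-two-nonneighbours G
  ... | inj₂ (v , a , b , v≁a , v≁b , a≢b , a≢v , b≢v) =
    inj₂ (inj₂ (Structure.two-nonneighbours⇒𝒢₂ G (edgeStable⇒triangle {G = G} critical ese) leaves 7≤n
      v≁a v≁b a≢b a≢v b≢v))
  ... | inj₁ nearly with Fin.all? (λ u → Fin.all? (λ w → (u Fin.≟ w) ⊎-dec (u ~? w)))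
  ...   | yes complete = inj₁
    ((λ u w u≢w → Sum.fromInj₂ (λ u≡w → contradiction u≡w u≢w) (complete u w)) , r , odd)
  ...   | no incomplete = inj₂ (inj₁ (nearlyComplete⇒𝒢₁ G r odd 3≤r nearly λ complete →
    incomplete (equal-or-adjacent complete)))
    where
    equal-or-adjacent : Complete G → ∀ u w → u ≡ w ⊎ u ~ w
    equal-or-adjacent complete u w with u Fin.≟ w
    ... | yes u≡w = inj₁ u≡w
    ... | no  u≢w = inj₂ (complete u w u≢w)

  stable : OddComplete G ⊎ 𝒢₁ G ⊎ 𝒢₂ G → EdgeStableEquimatchable G
  stable (inj₁ (complete , _)) = nearlyComplete⇒edgeStable G r odd
    (λ v≁a _ a≢v _ → contradiction (complete _ _ (≢-sym a≢v)) v≁a)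
  stable (inj₂ (inj₁ G∈𝒢₁))    = nearlyComplete⇒edgeStable G r odd (𝒢₁⇒nearlyComplete G G∈𝒢₁)
  stable (inj₂ (inj₂ G∈𝒢₂))    = 𝒢₂⇒edgeStable G r odd leaves G∈𝒢₂
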